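{- Let $d\ge 1$ and $m\ge d$ be integers, let $n=2m+1$, and let $f_d:\{0,1\}^n\to\mathbb{R}$ be $f_d(x)=\left(\|x\|_1+d-m-1\right)^{\underline{2d}}$. Then the SoS hierarchy requires at least $\left\lceil\frac{n+2d-1}{2}\right\rceil$ levels to find the exact optimum of $\min_{x\in\{0,1\}^n} f_d(x)$; that is, for every integer level $t$ with $1\le t<\left\lceil\frac{n+2d-1}{2}\right\rceil$ the optimal value of the relaxation $\mathrm{SoS}_t(f_d)$ is strictly smaller than $\min_{x\in\{0,1\}^n} f_d(x)$.
   Context: Notation: $\|x\|_1=\sum_{i=1}^n x_i$ for $x\in\{0,1\}^n$; for a real number $k$ and an integer $r\ge 0$, $k^{\underline{r}}=k(k-1)\cdots(k-r+1)$ is the falling factorial. Let $N=\{1,\dots,n\}$. For $I\subseteq N$, $x_I\in\{0,1\}^n$ is the point with $x_i=1$ for $i\in I$ and $x_i=0$ for $i\in N\setminus I$. For an integer $q$, $\mathcal{P}_q(N)$ is the collection of subsets of $N$ of size at most $q$. For $I\subseteq N$, the zeta vector $Z_I\in\mathbb{R}^{\mathcal{P}_q(N)}$ is the $0/1$ vector whose $J$-th entry ($|J|\le q$) equals $1$ if and only if $J\subseteq I$. The $t$-th level (round) SoS relaxation $\mathrm{SoS}_t(f)$ of $\min_{x\in\{0,1\}^n} f(x)$ is the following optimization problem in the real variables $\{y_I^N : I\subseteq N\}$: minimize $\sum_{I\subseteq N} y_I^N f(x_I)$ subject to $\sum_{I\subseteq N} y_I^N=1$ and $\sum_{I\subseteq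 N} y_I^N Z_I Z_I^\top\succeq 0$ (positive semidefinite), where $Z_I\in\mathbb{R}^{\mathcal{P}_t(N)}$. Its optimal value is understood as the infimum of the objective over feasible points. -}

module Defs where

open import Data.Bool using (Bool; if_then_else_)
open import Data.Fin.Subset as Subset using (Subset; inside; outside)
open import Data.Fin.Subset.Properties using (_⊆?_)
open import Data.Integer as ℤ using ()
open import Data.List using (List; []; _∷_; _++_; map; foldr; mapMaybe)
open import Data.Maybe as Maybe using ()
open import Data.Nat as ℕ using (ℕ; zero; suc; _⊔_)
open import Data.Nat.Properties as ℕP using ()
open import Data.Product using (Σ-syntax; ∃-syntax; _×_; _,_; proj₁; proj₂)
open import Data.Rational as ℚ using (ℚ; 0ℚ; 1ℚ; ½; ∣_∣)
open import Data.Rational.Properties as ℚP using ()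
open import Data.Rational.Solver using (module +-*-Solver)
open import Data.Vec as Vec using (Vec; []; _∷_)
open import Relation.Binary.PropositionalEquality using (_≡_; refl; sym; trans; cong; subst)
open import Relation.Nullary using (does)
open import Relation.Nullary.Decidable using (dec⇒maybe)

-- Real numbers: Cauchy sequences of rationals, with a modulus of
-- convergence, compared through the setoid equality _≈_.

Cauchy : (ℕ → ℚ) → Set
Cauchy x = ∀ ε → 0ℚ ℚ.< ε → ∃[ N ] (∀ i j → N ℕ.≤ i → N ℕ.≤ j → ∣ x i ℚ.- x j ∣ ℚ.< ε)

record ℝ : Set where
  constructor mkℝ
  field
    seq    : ℕ → ℚ
    cauchy : Cauchy seq

open ℝ public

private
  halve : ∀ {ε} → 0ℚ ℚ.< ε → 0ℚ ℚ.< ½ ℚ.* ε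
  halve {ε} 0<ε = ℚP.positive⁻¹ (½ ℚ.* ε)
    {{ℚP.pos*pos⇒pos ½ ε {{ℚ.positive 0<ε}}}}

  halves : ∀ ε → ½ ℚ.* ε ℚ.+ ½ ℚ.* ε ≡ ε
  halves ε = trans (sym (ℚP.*-distribʳ-+ ε ½ ½)) (ℚP.*-identityˡ ε)

  const-cauchy : ∀ q → Cauchy (λ _ → q)
  const-cauchy q ε 0<ε = 0 , λ _ _ _ _ →
    subst (λ z → ∣ z ∣ ℚ.< ε) (sym (ℚP.+-inverseʳ q)) 0<ε

  neg-cauchy : ∀ x → Cauchy x → Cauchy (λ i → ℚ.- x i)
  neg-cauchy x cx ε 0<ε with cx ε 0<ε
  ... | N , h = N , λ i j N≤i N≤j → subst (ℚ._< ε)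
      (trans (sym (ℚP.∣-p∣≡∣p∣ (x i ℚ.- x j)))
             (cong ∣_∣ (ℚP.neg-distrib-+ (x i) (ℚ.- x j))))
      (h i j N≤i N≤j)

  +-cauchy : ∀ x y → Cauchy x → Cauchy y → Cauchy (λ i → x i ℚ.+ y i)
  +-cauchy x y cx cy ε 0<ε
    with cx (½ ℚ.* ε) (halve 0<ε) | cy (½ ℚ.* ε) (halve 0<ε)
  ... | M , hx | N , hy = M ⊔ N , λ i j K≤i K≤j → begin-strict
      ∣ (x i ℚ.+ y i) ℚ.- (x j ℚ.+ y j) ∣
        ≡⟨ cong ∣_∣ (regroup (x i) (y i) (x j) (y j)) ⟩
      ∣ (x i ℚ.- x j) ℚ.+ (y i ℚ.- y j) ∣
        ≤⟨ ℚP.∣p+q∣≤∣p∣+∣q∣ (x i ℚ.- x j) (y i ℚ.- y j) ⟩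
      ∣ x i ℚ.- x j ∣ ℚ.+ ∣ y i ℚ.- y j ∣
        <⟨ ℚP.+-mono-< (hx i j (ℕP.m⊔n≤o⇒m≤o M N K≤i) (ℕP.m⊔n≤o⇒m≤o M N K≤j))
                       (hy i j (ℕP.m⊔n≤o⇒n≤o M N K≤i) (ℕP.m⊔n≤o⇒n≤o M N K≤j)) ⟩
      ½ ℚ.* ε ℚ.+ ½ ℚ.* ε
        ≡⟨ halves ε ⟩
      ε ∎
    where
    open ℚP.≤-Reasoning
    open +-*-Solver
    regroup : ∀ a b c d → (a ℚ.+ b) ℚ.- (c ℚ.+ d) ≡ (a ℚ.- c) ℚ.+ (b ℚ.- d)
    regroup = solve 4 (λ a b c d → (a :+ b) :- (c :+ d) := (a :- c) :+ (b :- d)) refl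

  eventually-bounded : ∀ x → Cauchy x →
    ∃[ B ] ∃[ N ] (0ℚ ℚ.< B × (∀ i → N ℕ.≤ i → ∣ x i ∣ ℚ.≤ B))
  eventually-bounded x cx with cx 1ℚ (ℚP.positive⁻¹ 1ℚ)
  ... | N , h = 1ℚ ℚ.+ ∣ x N ∣ , N , 0<B , λ i N≤i → begin
      ∣ x i ∣                         ≡⟨ cong ∣_∣ (split (x i) (x N)) ⟩
      ∣ (x i ℚ.- x N) ℚ.+ x N ∣       ≤⟨ ℚP.∣p+q∣≤∣p∣+∣q∣ (x i ℚ.- x N) (x N) ⟩
      ∣ x i ℚ.- x N ∣ ℚ.+ ∣ x N ∣
        ≤⟨ ℚP.+-monoˡ-≤ ∣ x N ∣ (ℚP.<⇒≤ (h i N N≤i ℕP.≤-refl)) ⟩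
      1ℚ ℚ.+ ∣ x N ∣ ∎
    where
    open ℚP.≤-Reasoning
    open +-*-Solver
    split : ∀ a b → a ≡ (a ℚ.- b) ℚ.+ b
    split = solve 2 (λ a b → a := (a :- b) :+ b) refl
    0<B : 0ℚ ℚ.< 1ℚ ℚ.+ ∣ x N ∣
    0<B = ℚP.+-mono-<-≤ (ℚP.positive⁻¹ 1ℚ) (ℚP.0≤∣p∣ (x N))

  *-cauchy-bounded : ∀ x y B N → 0ℚ ℚ.< B →
    (∀ i → N ℕ.≤ i → ∣ x i ∣ ℚ.≤ B) → (∀ i → N ℕ.≤ i → ∣ y i ∣ ℚ.≤ B) →
    Cauchy x → Cauchy y → Cauchy (λ i → x i ℚ.* y i)
  *-cauchy-bounded x y B N 0<B bx by cx cy ε 0<ε = K , bound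
    where
    open ℚP.≤-Reasoning
    open +-*-Solver

    instance
      B-pos : ℚ.Positive B
      B-pos = ℚ.positive 0<B
      B-nonZero : ℚ.NonZero B
      B-nonZero = ℚP.pos⇒nonZero B

    δ = ℚ.1/ B ℚ.* (½ ℚ.* ε)

    0<δ : 0ℚ ℚ.< δ
    0<δ = ℚP.positive⁻¹ δ {{ℚP.pos*pos⇒pos (ℚ.1/ B) {{ℚP.1/pos⇒pos B}}
                              (½ ℚ.* ε) {{ℚ.positive (halve 0<ε)}}}}

    Bδ : B ℚ.* δ ≡ ½ ℚ.* ε
    Bδ = trans (sym (ℚP.*-assoc B (ℚ.1/ B) (½ ℚ.* ε)))
        (trans (cong (ℚ._* (½ ℚ.* ε)) (ℚP.*-inverseʳ B)) (ℚP.*-identityˡ (½ ℚ.* ε)))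

    small : ∀ a b → ∣ a ∣ ℚ.≤ B → ∣ b ∣ ℚ.< δ → ∣ a ℚ.* b ∣ ℚ.< ½ ℚ.* ε
    small a b a≤B b<δ = begin-strict
      ∣ a ℚ.* b ∣        ≡⟨ ℚP.∣p*q∣≡∣p∣*∣q∣ a b ⟩
      ∣ a ∣ ℚ.* ∣ b ∣    ≤⟨ ℚP.*-monoʳ-≤-nonNeg ∣ b ∣ {{ℚ.nonNegative (ℚP.0≤∣p∣ b)}} a≤B ⟩
      B ℚ.* ∣ b ∣        <⟨ ℚP.*-monoʳ-<-pos B b<δ ⟩
      B ℚ.* δ            ≡⟨ Bδ ⟩
      ½ ℚ.* ε ∎

    Mx = proj₁ (cx δ 0<δ)
    My = proj₁ (cy δ 0<δ)
    K  = N ⊔ (Mx ⊔ My)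

    regroup : ∀ a b c d → a ℚ.* b ℚ.- c ℚ.* d ≡ a ℚ.* (b ℚ.- d) ℚ.+ d ℚ.* (a ℚ.- c)
    regroup = solve 4 (λ a b c d → a :* b :- c :* d := a :* (b :- d) :+ d :* (a :- c)) refl

    bound : ∀ i j → K ℕ.≤ i → K ℕ.≤ j → ∣ x i ℚ.* y i ℚ.- x j ℚ.* y j ∣ ℚ.< ε
    bound i j K≤i K≤j = begin-strict
      ∣ x i ℚ.* y i ℚ.- x j ℚ.* y j ∣
        ≡⟨ cong ∣_∣ (regroup (x i) (y i) (x j) (y j)) ⟩
      ∣ x i ℚ.* (y i ℚ.- y j) ℚ.+ y j ℚ.* (x i ℚ.- x j) ∣
        ≤⟨ ℚP.∣p+q∣≤∣p∣+∣q∣ (x i ℚ.* (y i ℚ.- y j)) (y j ℚ.* (x i ℚ.- x j)) ⟩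
      ∣ x i ℚ.* (y i ℚ.- y j) ∣ ℚ.+ ∣ y j ℚ.* (x i ℚ.- x j) ∣
        <⟨ ℚP.+-mono-<
             (small (x i) (y i ℚ.- y j) (bx i (N≤ K≤i))
                    (proj₂ (cy δ 0<δ) i j (ℕP.m⊔n≤o⇒n≤o Mx My (M≤ K≤i))
                                          (ℕP.m⊔n≤o⇒n≤o Mx My (M≤ K≤j))))
             (small (y j) (x i ℚ.- x j) (by j (N≤ K≤j))
                    (proj₂ (cx δ 0<δ) i j (ℕP.m⊔n≤o⇒m≤o Mx My (M≤ K≤i))
                                          (ℕP.m⊔n≤o⇒m≤o Mx My (M≤ K≤j)))) ⟩
      ½ ℚ.* ε ℚ.+ ½ ℚ.* ε
        ≡⟨ halves ε ⟩
      ε ∎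
      where
      N≤ : ∀ {k} → K ℕ.≤ k → N ℕ.≤ k
      N≤ = ℕP.m⊔n≤o⇒m≤o N (Mx ⊔ My)
      M≤ : ∀ {k} → K ℕ.≤ k → (Mx ⊔ My) ℕ.≤ k
      M≤ = ℕP.m⊔n≤o⇒n≤o N (Mx ⊔ My)

  *-cauchy : ∀ x y → Cauchy x → Cauchy y → Cauchy (λ i → x i ℚ.* y i)
  *-cauchy x y cx cy =
    let (Bx , Nx , 0<Bx , bx) = eventually-bounded x cx
        (By , Ny , 0<By , by) = eventually-bounded y cy
    in *-cauchy-bounded x y (Bx ℚ.+ By) (Nx ⊔ Ny) (ℚP.+-mono-< 0<Bx 0<By)
         (λ i K≤i → ℚP.≤-trans (bx i (ℕP.m⊔n≤o⇒m≤o Nx Ny K≤i)) (p≤p+q Bx By 0<By))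
         (λ i K≤i → ℚP.≤-trans (by i (ℕP.m⊔n≤o⇒n≤o Nx Ny K≤i)) (q≤p+q Bx By 0<Bx))
         cx cy
    where
    p≤p+q : ∀ p q → 0ℚ ℚ.< q → p ℚ.≤ p ℚ.+ q
    p≤p+q p q 0<q = subst (ℚ._≤ p ℚ.+ q) (ℚP.+-identityʳ p) (ℚP.+-monoʳ-≤ p (ℚP.<⇒≤ 0<q))
    q≤p+q : ∀ p q → 0ℚ ℚ.< p → q ℚ.≤ p ℚ.+ q
    q≤p+q p q 0<p = subst (ℚ._≤ p ℚ.+ q) (ℚP.+-identityˡ q) (ℚP.+-monoˡ-≤ q (ℚP.<⇒≤ 0<p))

infix  8 -_
infixl 7 _*_
infixl 6 _+_ _-_
infix  4 _≈_ _≤_ _<_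

fromℚ : ℚ → ℝ
fromℚ q = mkℝ (λ _ → q) (const-cauchy q)

fromℕ : ℕ → ℝ
fromℕ k = fromℚ (ℤ.+ k ℚ./ 1)

0ℝ 1ℝ : ℝ
0ℝ = fromℕ 0
1ℝ = fromℕ 1

_+_ _*_ : ℝ → ℝ → ℝ
x + y = mkℝ (λ i → seq x i ℚ.+ seq y i) (+-cauchy (seq x) (seq y) (cauchy x) (cauchy y))
x * y = mkℝ (λ i → seq x i ℚ.* seq y i) (*-cauchy (seq x) (seq y) (cauchy x) (cauchy y))

-_ : ℝ → ℝ
- x = mkℝ (λ i → ℚ.- seq x i) (neg-cauchy (seq x) (cauchy x))

_-_ : ℝ → ℝ → ℝ
x - y = x + - y

_≈_ _≤_ _<_ : ℝ → ℝ → Set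
x ≈ y = ∀ ε → 0ℚ ℚ.< ε → ∃[ N ] (∀ i → N ℕ.≤ i → ∣ seq x i ℚ.- seq y i ∣ ℚ.< ε)
x ≤ y = ∀ ε → 0ℚ ℚ.< ε → ∃[ N ] (∀ i → N ℕ.≤ i → seq x i ℚ.< seq y i ℚ.+ ε)
x < y = ∃[ ε ] (0ℚ ℚ.< ε × ∃[ N ] (∀ i → N ℕ.≤ i → seq x i ℚ.+ ε ℚ.< seq y i))

sumOver : {A : Set} → List A → (A → ℝ) → ℝ
sumOver xs g = foldr _+_ 0ℝ (map g xs)

fallingFactorial : ℝ → ℕ → ℝ
fallingFactorial k zero    = 1ℝ
fallingFactorial k (suc r) = fallingFactorial k r * (k - fromℕ r)

-- An infimum of a set of reals is an extended real which need not be
-- attained, and may be -∞ (unbounded below) or +∞ (empty set).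
-- Constructively it is given by the set of rationals strictly above it.

record UpperReal : Set₁ where
  field
    above   : ℚ → Set
    upward  : ∀ {p q} → p ℚ.< q → above p → above q
    rounded : ∀ {q} → above q → ∃[ p ] (p ℚ.< q × above p)

open UpperReal public

infix 4 _≤ᵁ_ _<ᵁ_

_≤ᵁ_ : UpperReal → UpperReal → Set
u ≤ᵁ v = ∀ q → above v q → above u q

_<ᵁ_ : UpperReal → ℝ → Set
u <ᵁ x = ∃[ q ] (above u q × fromℚ q < x)

private
  <-upward : ∀ x {p q} → p ℚ.< q → x < fromℚ p → x < fromℚ q
  <-upward x p<q (ε , 0<ε , N , h) = ε , 0<ε , N , λ i N≤i → ℚP.<-trans (h i N≤i) p<q

  <-rounded : ∀ x {q} → x < fromℚ q → ∃[ p ] (p ℚ.< q × x < fromℚ p)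
  <-rounded x {q} (ε , 0<ε , N , h) = q ℚ.- ½ ℚ.* ε , p<q , ½ ℚ.* ε , halve 0<ε , N , λ i N≤i →
      begin-strict
        seq x i ℚ.+ ½ ℚ.* ε
          ≡⟨ solve 2 (λ a b → a :+ b := (a :+ (b :+ b)) :- b) refl (seq x i) (½ ℚ.* ε) ⟩
        (seq x i ℚ.+ (½ ℚ.* ε ℚ.+ ½ ℚ.* ε)) ℚ.- ½ ℚ.* ε
          ≡⟨ cong (λ z → (seq x i ℚ.+ z) ℚ.- ½ ℚ.* ε) (halves ε) ⟩
        (seq x i ℚ.+ ε) ℚ.- ½ ℚ.* ε
          <⟨ ℚP.+-monoˡ-< (ℚ.- (½ ℚ.* ε)) (h i N≤i) ⟩
        q ℚ.- ½ ℚ.* ε ∎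
    where
    open ℚP.≤-Reasoning
    open +-*-Solver
    p<q : q ℚ.- ½ ℚ.* ε ℚ.< q
    p<q = begin-strict
      q ℚ.- ½ ℚ.* ε  <⟨ ℚP.+-monoʳ-< q (ℚP.neg-antimono-< (halve 0<ε)) ⟩
      q ℚ.+ 0ℚ       ≡⟨ ℚP.+-identityʳ q ⟩
      q ∎

fromℝ : ℝ → UpperReal
fromℝ x = record
  { above   = λ q → x < fromℚ q
  ; upward  = <-upward x
  ; rounded = <-rounded x
  }

infimum : {A : Set} (P : A → Set) (g : A → ℝ) → UpperReal
infimum P g = record
  { above   = λ q → ∃[ a ] (P a × g a < fromℚ q)
  ; upward  = λ { p<q (a , Pa , lt) → a , Pa , <-upward (g a) p<q lt }
  ; rounded = λ { (a , Pa , lt) → let (p , p<q , lt′) = <-rounded (g a) lt in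
                                  p , p<q , a , Pa , lt′ }
  }

infimum-lower : ∀ {A P} (g : A → ℝ) a → P a → infimum P g ≤ᵁ fromℝ (g a)
infimum-lower g a Pa q lt = a , Pa , lt

infimum-greatest : ∀ {A P} (g : A → ℝ) u →
  (∀ a → P a → u ≤ᵁ fromℝ (g a)) → u ≤ᵁ infimum P g
infimum-greatest g u lb q (a , Pa , lt) = lb a Pa q lt

IsMinimum : {A : Set} → (A → ℝ) → ℝ → Set
IsMinimum f μ = (∃[ x ] f x ≈ μ) × (∀ x → μ ≤ f x)

Cube : ℕ → Set
Cube n = Vec Bool n

‖_‖₁ : ∀ {n} → Cube n → ℕ
‖ x ‖₁ = Vec.sum (Vec.map (λ b → if b then 1 else 0) x)

-- A Subset is by definition its characteristic vector.
point : ∀ {n} → Subset n → Cube n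
point I = I

allSubsets : ∀ n → List (Subset n)
allSubsets zero    = [] ∷ []
allSubsets (suc n) = map (outside ∷_) (allSubsets n) ++ map (inside ∷_) (allSubsets n)

𝒫 : ℕ → ℕ → Set
𝒫 q n = Σ[ J ∈ Subset n ] Subset.∣ J ∣ ℕ.≤ q

all𝒫 : ∀ q n → List (𝒫 q n)
all𝒫 q n = mapMaybe (λ J → Maybe.map (J ,_) (dec⇒maybe (Subset.∣ J ∣ ℕP.≤? q))) (allSubsets n)

zeta : ∀ {q n} → Subset n → 𝒫 q n → ℝ
zeta I (J , _) = if does (J ⊆? I) then 1ℝ else 0ℝ

PositiveSemidefinite : ∀ {q n} → (𝒫 q n → 𝒫 q n → ℝ) → Set
PositiveSemidefinite {q} {n} M =
    (∀ J K → M J K ≈ M K J)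
  × (∀ (v : 𝒫 q n → ℝ) →
       0ℝ ≤ sumOver (all𝒫 q n) λ J → sumOver (all𝒫 q n) λ K → v J * M J K * v K)

momentMatrix : ∀ t {n} → (Subset n → ℝ) → 𝒫 t n → 𝒫 t n → ℝ
momentMatrix t {n} y J K = sumOver (allSubsets n) λ I → y I * (zeta I J * zeta I K)

Feasible : ∀ t {n} → (Subset n → ℝ) → Set
Feasible t {n} y =
  sumOver (allSubsets n) y ≈ 1ℝ × PositiveSemidefinite (momentMatrix t y)

objective : ∀ {n} → (Cube n → ℝ) → (Subset n → ℝ) → ℝ
objective {n} f y = sumOver (allSubsets n) λ I → y I * f (point I)

SoS : ∀ t {n} → (Cube n → ℝ) → UpperReal
SoS t f = infimum (Feasible t) (objective f)

-- Depends on m as well as d; intended for n = 2m + 1.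
fPoly : ∀ (d m : ℕ) {n} → Cube n → ℝ
fPoly d m x =
  fallingFactorial (fromℕ ‖ x ‖₁ + fromℕ d - fromℕ m - 1ℝ) (2 ℕ.* d)

{-# OPTIONS --safe #-}

-- The minimum is 0, since f_d vanishes on the 2d middle levels and is positive elsewhere. With the
-- half-integral poles α strictly between consecutive middle levels, 2d-1 in number, give each point of
-- level k the mass y_k = ± (-1)ᵏ / ∏ (k - α), which is positive on the middle levels. Partial fractions
-- turn Σₖ C(n,k) y_k h(k), for polynomials h of degree ≤ n + 2d - 2, into a positive combination of the
-- values h(α).
--
-- A form Σ_I y_|I| g(I)² with deg g ≤ t is symmetrised one coordinate at a time. Each step splits off the
-- square of a function antisymmetric in two coordinates, hence a form of the same kind in n - 2 variables
-- and of degree t - 1, so only the sums Σₖ C(n-2j,k) y_{j+k} q(k)² with deg q ≤ t - j remain. If levels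
-- j, …, n-j are all middle ones, every term is nonnegative; otherwise q² has degree small enough for the
-- partial fractions, whose coefficients are then still positive.
--
-- In the variable y = α - n/2 the objective becomes a central difference of order 2d-2 of
-- ∏ 1/(κ² - y²), up to a negative factor, where κ + n/2 ranges over the levels above the middle ones.
-- Multiplying by κ² - y² removes a factor of the product and relates the central differences of orders
-- 2f and 2f - 2, so that by induction all these differences are positive.
module Submission where

module Pseudomoments where

  open import Data.Bool using (true; false; if_then_else_)
  open import Data.Empty using (⊥-elim)
  open import Data.Fin.Subset as Subset using (Subset)
  open import Data.Fin.Subset.Properties using (_⊆?_)
  import Data.Integer as ℤ
  import Data.Integer.Properties as ℤP
  open import Data.List using (List; []; _∷_; _++_; map)
  open import Data.Nat as ℕ using (ℕ; zero; suc; pred; z≤n; s≤s)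
  import Data.Nat.Properties as ℕP
  open import Data.Product using (∃-syntax; _×_; _,_; proj₁; proj₂)
  open import Data.Rational
  open import Data.Rational.Properties
  import Data.Rational.Unnormalised as ℚᵘ
  import Data.Rational.Unnormalised.Properties as ℚᵘP
  open import Data.Sum using (inj₁; inj₂)
  open import Data.Unit using (⊤; tt)
  open import Data.Vec using ([]; _∷_)
  open import Defs as D using
    ( Cube; ‖_‖₁; IsMinimum; SoS; _<ᵁ_; fPoly; ℝ; seq; fromℚ; 0ℝ; 1ℝ; sumOver; allSubsets
    ; 𝒫; all𝒫; zeta; momentMatrix; Feasible; objective; fallingFactorial )
  open import Function using (_∘_)
  open import Relation.Binary.PropositionalEquality
  open import Relation.Nullary using (yes; no; does)
  open import Relation.Nullary.Decidable using (dec⇒maybe; toWitness)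
  open import Tactic.RingSolver using (solve-∀)
  open import Tactic.RingSolver.Core.AlmostCommutativeRing using (fromCommutativeRing)

  ℚ-ring = fromCommutativeRing +-*-commutativeRing (λ x → dec⇒maybe (0ℚ ≟ x))

  -- Finite differences

  +-nonneg : ∀ {p q} → 0ℚ ≤ p → 0ℚ ≤ q → 0ℚ ≤ p + q
  +-nonneg = +-mono-≤

  +-pos-nonneg : ∀ {p q} → 0ℚ < p → 0ℚ ≤ q → 0ℚ < p + q
  +-pos-nonneg = +-mono-<-≤

  *-nonneg : ∀ {p q} → 0ℚ ≤ p → 0ℚ ≤ q → 0ℚ ≤ p * q
  *-nonneg {p} {q} 0≤p 0≤q = nonNegative⁻¹ (p * q)
    {{nonNeg*nonNeg⇒nonNeg p {{nonNegative 0≤p}} q {{nonNegative 0≤q}}}}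

  *-pos : ∀ {p q} → 0ℚ < p → 0ℚ < q → 0ℚ < p * q
  *-pos {p} {q} 0<p 0<q = positive⁻¹ (p * q)
    {{pos*pos⇒pos p {{positive 0<p}} q {{positive 0<q}}}}

  *-cancel-pos : ∀ {p q} → 0ℚ < p → 0ℚ < p * q → 0ℚ < q
  *-cancel-pos {p} {q} 0<p h =
    *-cancelˡ-<-nonNeg p {{nonNegative (<⇒≤ 0<p)}} (subst (_< p * q) (sym (*-zeroʳ p)) h)

  *-cancel-nonneg : ∀ {p q} → 0ℚ < p → 0ℚ ≤ p * q → 0ℚ ≤ q
  *-cancel-nonneg {p} {q} 0<p h =
    *-cancelˡ-≤-pos p {{positive 0<p}} (subst (_≤ p * q) (sym (*-zeroʳ p)) h)

  square-nonneg : ∀ q → 0ℚ ≤ q * q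
  square-nonneg q with ≤-total 0ℚ q
  ... | inj₁ 0≤q = *-nonneg 0≤q 0≤q
  ... | inj₂ q≤0 = subst (0ℚ ≤_) (neg*neg q) (*-nonneg (neg-antimono-≤ q≤0) (neg-antimono-≤ q≤0))
    where
    neg*neg : ∀ q → - q * - q ≡ q * q
    neg*neg = solve-∀ ℚ-ring

  difference-pos : ∀ {p q} → p < q → 0ℚ < q - p
  difference-pos {p} {q} p<q = subst (_< q - p) (+-inverseʳ p) (+-monoˡ-< (- p) p<q)

  difference-nonneg : ∀ {p q} → p ≤ q → 0ℚ ≤ q - p
  difference-nonneg {p} {q} p≤q = subst (_≤ q - p) (+-inverseʳ p) (+-monoˡ-≤ (- p) p≤q)

  -- The junk value at zero is 0.
  recip : ℚ → ℚ
  recip q with q ≟ 0ℚ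
  ... | yes _   = 0ℚ
  ... | no q≢0 = (1/ q) {{≢-nonZero q≢0}}

  recip-inverse : ∀ {q} → q ≢ 0ℚ → q * recip q ≡ 1ℚ
  recip-inverse {q} q≢0 with q ≟ 0ℚ
  ... | yes q≡0 = ⊥-elim (q≢0 q≡0)
  ... | no q≢0′ = *-inverseʳ q {{≢-nonZero q≢0′}}

  recip-pos : ∀ {q} → 0ℚ < q → 0ℚ < recip q
  recip-pos {q} 0<q = *-cancel-pos 0<q
    (subst (0ℚ <_) (sym (recip-inverse {q} (λ q≡0 → <-irrefl (sym q≡0) 0<q))) (positive⁻¹ 1ℚ))

  ι : ℕ → ℚ
  ι zero    = 0ℚ
  ι (suc k) = 1ℚ + ι k

  ι-+ : ∀ j k → ι (j ℕ.+ k) ≡ ι j + ι k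
  ι-+ zero    k = sym (+-identityˡ (ι k))
  ι-+ (suc j) k = trans (cong (1ℚ +_) (ι-+ j k)) (sym (+-assoc 1ℚ (ι j) (ι k)))

  ι-∸ : ∀ {j k} → k ℕ.≤ j → ι (j ℕ.∸ k) ≡ ι j - ι k
  ι-∸ {j} {k} k≤j = trans (cancel (ι (j ℕ.∸ k)) (ι k))
    (cong (_- ι k) (trans (sym (ι-+ (j ℕ.∸ k) k)) (cong ι (ℕP.m∸n+n≡m k≤j))))
    where
    cancel : ∀ p q → p ≡ p + q - q
    cancel = solve-∀ ℚ-ring

  ι-nonneg : ∀ k → 0ℚ ≤ ι k
  ι-nonneg zero    = ≤-refl
  ι-nonneg (suc k) = +-nonneg (nonNegative⁻¹ 1ℚ) (ι-nonneg k)

  ι-pos : ∀ k → 0ℚ < ι (suc k)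
  ι-pos k = +-pos-nonneg (positive⁻¹ 1ℚ) (ι-nonneg k)

  ι-mono-≤ : ∀ {j k} → j ℕ.≤ k → ι j ≤ ι k
  ι-mono-≤ {k = k} z≤n = ι-nonneg k
  ι-mono-≤ (s≤s j≤k) = +-monoʳ-≤ 1ℚ (ι-mono-≤ j≤k)

  -- Keeps the poles, which are half-integers, off the levels, so that no denominator at a pole
  -- takes the junk value of `recip`.
  ½+ι≢ι : ∀ k l → ½ + ι k ≢ ι l
  ½+ι≢ι zero    zero    ()
  ½+ι≢ι zero    (suc l) eq = <-irrefl eq
    (<-≤-trans (toWitness {a? = ½ <? 1ℚ} _) (+-mono-≤ (≤-refl {1ℚ}) (ι-nonneg l)))
  ½+ι≢ι (suc k) zero    eq = <-irrefl (sym eq) (+-mono-< (positive⁻¹ ½) (ι-pos k))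
  ½+ι≢ι (suc k) (suc l) eq = ½+ι≢ι k l (trans (shift (ι k)) (trans (cong (_- 1ℚ) eq) (unshift (ι l))))
    where
    shift : ∀ p → ½ + p ≡ ½ + (1ℚ + p) - 1ℚ
    shift = solve-∀ ℚ-ring
    unshift : ∀ p → 1ℚ + p - 1ℚ ≡ p
    unshift = solve-∀ ℚ-ring

  ½-ι+ι≢0 : ∀ l k → ½ - ι l + ι k ≢ 0ℚ
  ½-ι+ι≢0 l k eq = ½+ι≢ι k l (trans (regroup (ι l) (ι k)) (trans (cong (_+ ι l) eq) (+-identityˡ (ι l))))
    where
    regroup : ∀ p q → ½ + q ≡ ½ - p + q + p
    regroup = solve-∀ ℚ-ring

  sgn : ℕ → ℚ
  sgn zero    = 1ℚ
  sgn (suc k) = - sgn k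

  sgn-+ : ∀ j k → sgn (j ℕ.+ k) ≡ sgn j * sgn k
  sgn-+ zero    k = sym (*-identityˡ (sgn k))
  sgn-+ (suc j) k = trans (cong -_ (sgn-+ j k)) (neg-distribˡ-* (sgn j) (sgn k))

  sgn-square : ∀ k → sgn k * sgn k ≡ 1ℚ
  sgn-square zero    = refl
  sgn-square (suc k) = trans (neg*neg (sgn k)) (sgn-square k)
    where
    neg*neg : ∀ q → - q * - q ≡ q * q
    neg*neg = solve-∀ ℚ-ring

  sgn-∸ : ∀ {j k} → k ℕ.≤ j → sgn j * sgn k ≡ sgn (j ℕ.∸ k)
  sgn-∸ {j} {k} k≤j = begin
    sgn j * sgn k                         ≡⟨ cong (λ l → sgn l * sgn k) (ℕP.m∸n+n≡m k≤j) ⟨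
    sgn (j ℕ.∸ k ℕ.+ k) * sgn k           ≡⟨ cong (_* sgn k) (sgn-+ (j ℕ.∸ k) k) ⟩
    sgn (j ℕ.∸ k) * sgn k * sgn k         ≡⟨ *-assoc (sgn (j ℕ.∸ k)) (sgn k) (sgn k) ⟩
    sgn (j ℕ.∸ k) * (sgn k * sgn k)       ≡⟨ cong (sgn (j ℕ.∸ k) *_) (sgn-square k) ⟩
    sgn (j ℕ.∸ k) * 1ℚ                    ≡⟨ *-identityʳ (sgn (j ℕ.∸ k)) ⟩
    sgn (j ℕ.∸ k)                         ∎
    where open ≡-Reasoning

  -- binSum r φ = Σₖ C(r,k) φ(k), with the binomial coefficients generated by Pascal's rule.
  binSum : ℕ → (ℕ → ℚ) → ℚ
  binSum zero    φ = φ 0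
  binSum (suc r) φ = binSum r φ + binSum r (φ ∘ suc)

  binSum-cong : ∀ r {φ ψ} → (∀ k → φ k ≡ ψ k) → binSum r φ ≡ binSum r ψ
  binSum-cong zero    eq = eq 0
  binSum-cong (suc r) eq = cong₂ _+_ (binSum-cong r eq) (binSum-cong r (eq ∘ suc))

  +-interchange : ∀ a b c d → (a + b) + (c + d) ≡ (a + c) + (b + d)
  +-interchange = solve-∀ ℚ-ring

  binSum-+ : ∀ r φ ψ → binSum r (λ k → φ k + ψ k) ≡ binSum r φ + binSum r ψ
  binSum-+ zero    φ ψ = refl
  binSum-+ (suc r) φ ψ = trans (cong₂ _+_ (binSum-+ r φ ψ) (binSum-+ r (φ ∘ suc) (ψ ∘ suc)))
    (+-interchange (binSum r φ) (binSum r ψ) (binSum r (φ ∘ suc)) (binSum r (ψ ∘ suc)))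

  binSum-* : ∀ r c φ → binSum r (λ k → c * φ k) ≡ c * binSum r φ
  binSum-* zero    c φ = refl
  binSum-* (suc r) c φ = trans (cong₂ _+_ (binSum-* r c φ) (binSum-* r c (φ ∘ suc)))
    (sym (*-distribˡ-+ c (binSum r φ) (binSum r (φ ∘ suc))))

  binSum-neg : ∀ r φ → binSum r (λ k → - φ k) ≡ - binSum r φ
  binSum-neg zero    φ = refl
  binSum-neg (suc r) φ = trans (cong₂ _+_ (binSum-neg r φ) (binSum-neg r (φ ∘ suc)))
    (sym (neg-distrib-+ (binSum r φ) (binSum r (φ ∘ suc))))

  binSum-swap : ∀ r s (Φ : ℕ → ℕ → ℚ) →
    binSum r (λ k → binSum s (Φ k)) ≡ binSum s (λ i → binSum r (λ k → Φ k i))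
  binSum-swap zero    s Φ = refl
  binSum-swap (suc r) s Φ = trans (cong₂ _+_ (binSum-swap r s Φ) (binSum-swap r s (Φ ∘ suc)))
    (sym (binSum-+ s _ _))

  binSum-nonneg : ∀ r {φ} → (∀ k → k ℕ.≤ r → 0ℚ ≤ φ k) → 0ℚ ≤ binSum r φ
  binSum-nonneg zero    h = h 0 z≤n
  binSum-nonneg (suc r) h = +-nonneg (binSum-nonneg r (λ k k≤r → h k (ℕP.m≤n⇒m≤1+n k≤r)))
                                     (binSum-nonneg r (λ k k≤r → h (suc k) (s≤s k≤r)))

  binSum-pos : ∀ r {φ} → (∀ k → k ℕ.≤ r → 0ℚ < φ k) → 0ℚ < binSum r φ
  binSum-pos zero    h = h 0 z≤n
  binSum-pos (suc r) h = +-pos-nonneg (binSum-pos r (λ k k≤r → h k (ℕP.m≤n⇒m≤1+n k≤r)))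
                           (<⇒≤ (binSum-pos r (λ k k≤r → h (suc k) (s≤s k≤r))))

  -- k C(r+1,k) = (r+1) C(r,k-1)
  binSum-absorb : ∀ r φ → binSum (suc r) (λ k → ι k * φ k) ≡ ι (suc r) * binSum r (φ ∘ suc)
  binSum-absorb zero    φ = simplify (φ 0) (φ 1)
    where
    simplify : ∀ a b → 0ℚ * a + (1ℚ + 0ℚ) * b ≡ (1ℚ + 0ℚ) * b
    simplify = solve-∀ ℚ-ring
  binSum-absorb (suc r) φ = begin
    binSum (suc r) (λ k → ι k * φ k) + binSum (suc r) (λ k → ι (suc k) * φ (suc k))
      ≡⟨ cong₂ _+_ (binSum-absorb r φ)
           (trans (binSum-cong (suc r) (λ k → split (ι k) (φ (suc k)))) (binSum-+ (suc r) (φ ∘ suc) _)) ⟩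
    ι (suc r) * b + (b′ + binSum (suc r) (λ k → ι k * φ (suc k)))
      ≡⟨ cong (λ z → ι (suc r) * b + (b′ + z)) (binSum-absorb r (φ ∘ suc)) ⟩
    ι (suc r) * b + (b′ + ι (suc r) * binSum r (φ ∘ suc ∘ suc))
      ≡⟨ collect (ι (suc r)) b (binSum r (φ ∘ suc ∘ suc)) ⟩
    ι (suc (suc r)) * b′ ∎
    where
    open ≡-Reasoning
    b = binSum r (φ ∘ suc)
    b′ = binSum (suc r) (φ ∘ suc)
    split : ∀ i p → (1ℚ + i) * p ≡ p + i * p
    split = solve-∀ ℚ-ring
    collect : ∀ i p q → i * p + ((p + q) + i * q) ≡ (1ℚ + i) * (p + q)
    collect = solve-∀ ℚ-ring

  -- (r+1-k) C(r+1,k) = (r+1) C(r,k)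
  binSum-absorb′ : ∀ r φ →
    binSum (suc r) (λ k → (ι (suc r) - ι k) * φ k) ≡ ι (suc r) * binSum r φ
  binSum-absorb′ r φ = begin
    binSum (suc r) (λ k → (ι (suc r) - ι k) * φ k)
      ≡⟨ binSum-cong (suc r) (λ k → split (ι (suc r)) (ι k) (φ k)) ⟩
    binSum (suc r) (λ k → ι (suc r) * φ k + - (ι k * φ k))
      ≡⟨ binSum-+ (suc r) _ _ ⟩
    binSum (suc r) (λ k → ι (suc r) * φ k) + binSum (suc r) (λ k → - (ι k * φ k))
      ≡⟨ cong₂ _+_ (binSum-* (suc r) (ι (suc r)) φ)
           (trans (binSum-neg (suc r) _) (cong -_ (binSum-absorb r φ))) ⟩
    ι (suc r) * (binSum r φ + binSum r (φ ∘ suc)) + - (ι (suc r) * binSum r (φ ∘ suc))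
      ≡⟨ collect (ι (suc r)) (binSum r φ) (binSum r (φ ∘ suc)) ⟩
    ι (suc r) * binSum r φ ∎
    where
    open ≡-Reasoning
    split : ∀ R i p → (R - i) * p ≡ R * p + - (i * p)
    split = solve-∀ ℚ-ring
    collect : ∀ R p q → R * (p + q) + - (R * q) ≡ R * p
    collect = solve-∀ ℚ-ring

  -- (-1)ʳ times the r-th finite difference of φ at 0.
  altSum : ℕ → (ℕ → ℚ) → ℚ
  altSum r φ = binSum r (λ k → sgn k * φ k)

  altSum-suc : ∀ r φ → altSum (suc r) φ ≡ altSum r φ - altSum r (φ ∘ suc)
  altSum-suc r φ = cong (altSum r φ +_)
    (trans (binSum-cong r (λ k → sym (neg-distribˡ-* (sgn k) (φ (suc k))))) (binSum-neg r _))

  altSum-cong : ∀ r {φ ψ} → (∀ k → φ k ≡ ψ k) → altSum r φ ≡ altSum r ψ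
  altSum-cong r eq = binSum-cong r (λ k → cong (sgn k *_) (eq k))

  altSum-+ : ∀ r φ ψ → altSum r (λ k → φ k + ψ k) ≡ altSum r φ + altSum r ψ
  altSum-+ r φ ψ = trans (binSum-cong r (λ k → *-distribˡ-+ (sgn k) (φ k) (ψ k))) (binSum-+ r _ _)

  private
    *-swap : ∀ a b c → a * (b * c) ≡ b * (a * c)
    *-swap = solve-∀ ℚ-ring

  altSum-* : ∀ r c φ → altSum r (λ k → c * φ k) ≡ c * altSum r φ
  altSum-* r c φ = trans (binSum-cong r (λ k → *-swap (sgn k) c (φ k))) (binSum-* r c _)

  altSum-neg : ∀ r φ → altSum r (λ k → - φ k) ≡ - altSum r φ
  altSum-neg r φ = trans (binSum-cong r (λ k → sym (neg-distribʳ-* (sgn k) (φ k)))) (binSum-neg r _)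

  altSum-- : ∀ r φ ψ → altSum r (λ k → φ k - ψ k) ≡ altSum r φ - altSum r ψ
  altSum-- r φ ψ = trans (altSum-+ r φ (λ k → - ψ k)) (cong (altSum r φ +_) (altSum-neg r ψ))

  altSum-difference : ∀ r φ → altSum (suc r) φ ≡ - altSum r (λ k → φ (suc k) - φ k)
  altSum-difference r φ = trans (altSum-suc r φ)
    (trans (swap (altSum r φ) (altSum r (φ ∘ suc))) (cong -_ (sym (altSum-- r (φ ∘ suc) φ))))
    where
    swap : ∀ a b → a - b ≡ - (b - a)
    swap = solve-∀ ℚ-ring

  altSum-swap : ∀ r s (Φ : ℕ → ℕ → ℚ) →
    altSum r (λ k → altSum s (Φ k)) ≡ altSum s (λ i → altSum r (λ k → Φ k i))
  altSum-swap r s Φ = begin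
    binSum r (λ k → sgn k * altSum s (Φ k))
      ≡⟨ binSum-cong r (λ k → sym (altSum-* s (sgn k) (Φ k))) ⟩
    binSum r (λ k → altSum s (λ i → sgn k * Φ k i))
      ≡⟨ binSum-swap r s (λ k i → sgn i * (sgn k * Φ k i)) ⟩
    binSum s (λ i → binSum r (λ k → sgn i * (sgn k * Φ k i)))
      ≡⟨ binSum-cong s (λ i → binSum-* r (sgn i) _) ⟩
    binSum s (λ i → sgn i * altSum r (λ k → Φ k i)) ∎
    where open ≡-Reasoning

  altSum-const : ∀ r {φ} → (∀ k → φ (suc k) ≡ φ k) → altSum (suc r) φ ≡ 0ℚ
  altSum-const r {φ} eq = trans (altSum-suc r φ)
    (trans (cong (λ z → altSum r φ - z) (altSum-cong r eq)) (+-inverseʳ (altSum r φ)))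

  altSum-absorb : ∀ r φ → altSum (suc r) (λ k → ι k * φ k) ≡ - (ι (suc r) * altSum r (φ ∘ suc))
  altSum-absorb r φ = begin
    binSum (suc r) (λ k → sgn k * (ι k * φ k))
      ≡⟨ binSum-cong (suc r) (λ k → *-swap (sgn k) (ι k) (φ k)) ⟩
    binSum (suc r) (λ k → ι k * (sgn k * φ k))
      ≡⟨ binSum-absorb r (λ k → sgn k * φ k) ⟩
    ι (suc r) * binSum r (λ k → - sgn k * φ (suc k))
      ≡⟨ cong (ι (suc r) *_) (trans (binSum-cong r (λ k → sym (neg-distribˡ-* (sgn k) (φ (suc k)))))
                                    (binSum-neg r _)) ⟩
    ι (suc r) * - altSum r (φ ∘ suc)
      ≡⟨ neg-distribʳ-* (ι (suc r)) (altSum r (φ ∘ suc)) ⟨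
    - (ι (suc r) * altSum r (φ ∘ suc)) ∎
    where open ≡-Reasoning

  -- Leibniz rule for a difference against a linear factor: `ι k` is absorbed into the binomial
  -- coefficient. The companion `altSum-linear′` trades the shifted lower difference for the
  -- unshifted one; `altSum-square` combines both.
  altSum-linear : ∀ r x φ →
    altSum (suc r) (λ k → (x + ι k) * φ k) ≡ x * altSum (suc r) φ - ι (suc r) * altSum r (φ ∘ suc)
  altSum-linear r x φ = trans (altSum-cong (suc r) (λ k → *-distribʳ-+ (φ k) x (ι k)))
    (trans (altSum-+ (suc r) _ _) (cong₂ _+_ (altSum-* (suc r) x φ) (altSum-absorb r φ)))

  altSum-linear′ : ∀ r x φ →
    altSum (suc r) (λ k → (x + ι k) * φ k) ≡ (x + ι (suc r)) * altSum (suc r) φ - ι (suc r) * altSum r φ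
  altSum-linear′ r x φ = begin
    altSum (suc r) (λ k → (x + ι k) * φ k) ≡⟨ altSum-linear r x φ ⟩
    x * v - R * v′                         ≡⟨ regroup x R v v₀ v′ ⟩
    x * v + R * (v₀ - v′) - R * v₀         ≡⟨ cong (λ z → x * v + R * z - R * v₀) (altSum-suc r φ) ⟨
    x * v + R * v - R * v₀                 ≡⟨ cong (_- R * v₀) (*-distribʳ-+ v x R) ⟨
    (x + R) * v - R * v₀                   ∎
    where
    open ≡-Reasoning
    R  = ι (suc r)
    v  = altSum (suc r) φ
    v₀ = altSum r φ
    v′ = altSum r (φ ∘ suc)
    regroup : ∀ x R v v₀ v′ → x * v - R * v′ ≡ x * v + R * (v₀ - v′) - R * v₀
    regroup = solve-∀ ℚ-ring

  -- The commutation rule of the central difference of order r+2 with multiplication by y².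
  altSum-square : ∀ r x φ → x + ι (2 ℕ.+ r) ≡ - x →
    altSum (2 ℕ.+ r) (λ k → (x + ι k) * ((x + ι k) * φ k)) ≡
      x * x * altSum (2 ℕ.+ r) φ + ι (2 ℕ.+ r) * ι (1 ℕ.+ r) * altSum r (φ ∘ suc)
  altSum-square r x φ centre = begin
    altSum (suc (suc r)) (λ k → (x + ι k) * ((x + ι k) * φ k))
      ≡⟨ altSum-linear (suc r) x (λ k → (x + ι k) * φ k) ⟩
    x * altSum (suc (suc r)) (λ k → (x + ι k) * φ k)
      - R₂ * altSum (suc r) (λ k → (x + ι (suc k)) * φ (suc k))
      ≡⟨ cong₂ (λ p q → x * p - R₂ * q) (altSum-linear′ (suc r) x φ)
           (trans (altSum-cong (suc r) (λ k → cong (_* φ (suc k)) (sym (+-assoc x 1ℚ (ι k)))))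
                  (altSum-linear′ r (x + 1ℚ) (φ ∘ suc))) ⟩
    x * ((x + R₂) * v₂ - R₂ * v) - R₂ * ((x + 1ℚ + R₁) * v′ - R₁ * w)
      ≡⟨ cong₂ (λ p q → x * (p * v₂ - R₂ * v) - R₂ * (q * v′ - R₁ * w)) centre
           (trans (+-assoc x 1ℚ R₁) centre) ⟩
    x * (- x * v₂ - R₂ * v) - R₂ * (- x * v′ - R₁ * w)
      ≡⟨ expand x R₂ R₁ v₂ v v′ w ⟩
    - (x * x) * v₂ - R₂ * x * (v - v′) + R₂ * R₁ * w
      ≡⟨ cong₂ (λ p q → - (x * x) * v₂ - p * x * q + R₂ * R₁ * w) R₂≡ (sym (altSum-suc (suc r) φ)) ⟩
    - (x * x) * v₂ - (- x - x) * x * v₂ + R₂ * R₁ * w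
      ≡⟨ collect x v₂ (R₂ * R₁ * w) ⟩
    x * x * v₂ + R₂ * R₁ * w ∎
    where
    open ≡-Reasoning
    R₂ = ι (2 ℕ.+ r)
    R₁ = ι (1 ℕ.+ r)
    v₂ = altSum (suc (suc r)) φ
    v  = altSum (suc r) φ
    v′ = altSum (suc r) (φ ∘ suc)
    w  = altSum r (φ ∘ suc)
    R₂≡ : R₂ ≡ - x - x
    R₂≡ = trans (cancel x R₂) (cong (_- x) centre)
      where
      cancel : ∀ x R → R ≡ x + R - x
      cancel = solve-∀ ℚ-ring
    expand : ∀ x R₂ R₁ v₂ v v′ w →
      x * (- x * v₂ - R₂ * v) - R₂ * (- x * v′ - R₁ * w) ≡
      - (x * x) * v₂ - R₂ * x * (v - v′) + R₂ * R₁ * w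
    expand = solve-∀ ℚ-ring
    collect : ∀ x v z → - (x * x) * v - (- x - x) * x * v + z ≡ x * x * v + z
    collect = solve-∀ ℚ-ring

  -- Polynomials and their degrees

  -- A filtration of functions on Y; Below T is to be read as "of degree < T", so that
  -- Below 0 contains only the zero function.
  record Filtration (Y : Set) : Set₁ where
    field
      Below      : ℕ → (Y → ℚ) → Set
      below-ext  : ∀ {T p q} → (∀ y → p y ≡ q y) → Below T p → Below T q
      below-zero : ∀ T → Below T (λ _ → 0ℚ)
      zero-below : ∀ {p} → Below 0 p → ∀ y → p y ≡ 0ℚ
      below-+    : ∀ {T p q} → Below T p → Below T q → Below T (λ y → p y + q y)
      below-*    : ∀ {T p} c → Below T p → Below T (λ y → c * p y)
      below-suc  : ∀ {T p} → Below T p → Below (suc T) p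

    below-≤ : ∀ {S T p} → S ℕ.≤ T → Below S p → Below T p
    below-≤ {T = zero}  z≤n b = b
    below-≤ {T = suc T} z≤n b = below-suc (below-≤ {T = T} z≤n b)
    below-≤ (s≤s S≤T) b = below-≤′ (ℕP.≤⇒≤′ (s≤s S≤T)) b
      where
      below-≤′ : ∀ {S T p} → S ℕ.≤′ T → Below S p → Below T p
      below-≤′ ℕ.≤′-refl       b = b
      below-≤′ (ℕ.≤′-step S≤T) b = below-suc (below-≤′ S≤T b)

    below-- : ∀ {T p q} → Below T p → Below T q → Below T (λ y → p y - q y)
    below-- {p = p} {q} bp bq =
      below-ext (λ y → minus (p y) (q y)) (below-+ bp (below-* (- 1ℚ) bq))
      where
      minus : ∀ a b → a + - 1ℚ * b ≡ a - b
      minus = solve-∀ ℚ-ring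

  open Filtration

  -- The degree bounded here is the total degree, that of the coefficients included.
  PolyBelow : ∀ {Y} → Filtration Y → ℕ → (ℚ → Y → ℚ) → Set
  PolyBelow C zero    F = ∀ x y → F x y ≡ 0ℚ
  PolyBelow C (suc T) F = ∃[ p ] ∃[ F₁ ]
    (Below C (suc T) p × PolyBelow C T F₁ × (∀ x y → F x y ≡ p y + x * F₁ x y))

  private
    zero-expansion : ∀ x → 0ℚ ≡ 0ℚ + x * 0ℚ
    zero-expansion = solve-∀ ℚ-ring

  module _ {Y : Set} (C : Filtration Y) where

    poly-ext : ∀ {T F G} → (∀ x y → F x y ≡ G x y) → PolyBelow C T F → PolyBelow C T G
    poly-ext {zero}  eq F≡0 x y = trans (sym (eq x y)) (F≡0 x y)
    poly-ext {suc T} eq (p , F₁ , bp , bF₁ , F≡) =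
      p , F₁ , bp , bF₁ , λ x y → trans (sym (eq x y)) (F≡ x y)

    poly-zero : ∀ T → PolyBelow C T (λ _ _ → 0ℚ)
    poly-zero zero    x y = refl
    poly-zero (suc T) = _ , _ , below-zero C (suc T) , poly-zero T , λ x _ → zero-expansion x

    poly-const : ∀ {T p} → Below C T p → PolyBelow C T (λ _ → p)
    poly-const {zero}      bp _ = zero-below C bp
    poly-const {suc T} {p} bp = p , _ , bp , poly-zero T , λ x y → expand (p y) x
      where
      expand : ∀ a x → a ≡ a + x * 0ℚ
      expand = solve-∀ ℚ-ring

    poly-+ : ∀ {T F G} → PolyBelow C T F → PolyBelow C T G → PolyBelow C T (λ x y → F x y + G x y)
    poly-+ {zero}  F≡0 G≡0 x y = trans (cong₂ _+_ (F≡0 x y) (G≡0 x y)) (+-identityˡ 0ℚ)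
    poly-+ {suc T} (p , F₁ , bp , bF₁ , F≡) (q , G₁ , bq , bG₁ , G≡) =
      _ , _ , below-+ C bp bq , poly-+ bF₁ bG₁ ,
      λ x y → trans (cong₂ _+_ (F≡ x y) (G≡ x y)) (collect (p y) (q y) x (F₁ x y) (G₁ x y))
      where
      collect : ∀ a b x f g → (a + x * f) + (b + x * g) ≡ (a + b) + x * (f + g)
      collect = solve-∀ ℚ-ring

    poly-* : ∀ {T F} c → PolyBelow C T F → PolyBelow C T (λ x y → c * F x y)
    poly-* {zero}  c F≡0 x y = trans (cong (c *_) (F≡0 x y)) (*-zeroʳ c)
    poly-* {suc T} c (p , F₁ , bp , bF₁ , F≡) =
      _ , _ , below-* C c bp , poly-* c bF₁ ,
      λ x y → trans (cong (c *_) (F≡ x y)) (distrib c (p y) x (F₁ x y))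
      where
      distrib : ∀ c a x f → c * (a + x * f) ≡ c * a + x * (c * f)
      distrib = solve-∀ ℚ-ring

    poly-X : ∀ {T F} → PolyBelow C (pred T) F → PolyBelow C T (λ x y → x * F x y)
    poly-X {zero}      F≡0 x y = trans (cong (x *_) (F≡0 x y)) (*-zeroʳ x)
    poly-X {suc T} {F} bF =
      _ , F , below-zero C (suc T) , bF , λ x y → sym (+-identityˡ (x * F x y))

    poly-suc : ∀ {T F} → PolyBelow C T F → PolyBelow C (suc T) F
    poly-suc {zero} F≡0 =
      _ , _ , below-zero C 1 , (λ _ _ → refl) , λ x y → trans (F≡0 x y) (zero-expansion x)
    poly-suc {suc T} (p , F₁ , bp , bF₁ , F≡) = p , F₁ , below-suc C bp , poly-suc bF₁ , F≡

    polynomials : Filtration (ℚ × Y)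
    polynomials = record
      { Below      = λ T F → PolyBelow C T (λ x y → F (x , y))
      ; below-ext  = λ eq → poly-ext (λ x y → eq (x , y))
      ; below-zero = poly-zero
      ; zero-below = λ F≡0 (x , y) → F≡0 x y
      ; below-+    = poly-+
      ; below-*    = poly-*
      ; below-suc  = poly-suc
      }

    poly-- : ∀ {T F G} → PolyBelow C T F → PolyBelow C T G → PolyBelow C T (λ x y → F x y - G x y)
    poly-- {F = F} {G} = below-- polynomials {p = λ (x , y) → F x y} {λ (x , y) → G x y}

    poly-shift : ∀ {T F} c → PolyBelow C T F → PolyBelow C T (λ x → F (x + c))
    poly-shift {zero}  c F≡0 x = F≡0 (x + c)
    poly-shift {suc T} c (p , F₁ , bp , bF₁ , F≡) = poly-ext
      (λ x y → sym (trans (F≡ (x + c) y) (expand (p y) x c (F₁ (x + c) y))))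
      (poly-+ (poly-const bp) (poly-+ (poly-suc (poly-* c shifted)) (poly-X shifted)))
      where
      shifted : PolyBelow C T (λ x → F₁ (x + c))
      shifted = poly-shift c bF₁
      expand : ∀ a x c f → a + (x + c) * f ≡ a + (c * f + x * f)
      expand = solve-∀ ℚ-ring

    poly-difference : ∀ {T F} → PolyBelow C T F →
      PolyBelow C (pred T) (λ x y → F (x + 1ℚ) y - F x y)
    poly-difference {zero}  F≡0 x y = trans (cong₂ _-_ (F≡0 (x + 1ℚ) y) (F≡0 x y)) (+-inverseʳ 0ℚ)
    poly-difference {suc T} (p , F₁ , bp , bF₁ , F≡) = poly-ext
      (λ x y → sym (trans (cong₂ _-_ (F≡ (x + 1ℚ) y) (F≡ x y))
                          (expand (p y) x (F₁ (x + 1ℚ) y) (F₁ x y))))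
      (poly-+ (poly-shift 1ℚ bF₁) (poly-X (poly-difference bF₁)))
      where
      expand : ∀ a x f g → (a + (x + 1ℚ) * f) - (a + x * g) ≡ f + x * (f - g)
      expand = solve-∀ ℚ-ring

    poly-backward-difference : ∀ {T F} → PolyBelow C T F →
      PolyBelow C (pred T) (λ x y → F x y - F (x - 1ℚ) y)
    poly-backward-difference {F = F} bF = poly-ext
      (λ x y → cong (λ z → F z y - F (x - 1ℚ) y) (cancel x))
      (poly-shift (- 1ℚ) (poly-difference bF))
      where
      cancel : ∀ x → x - 1ℚ + 1ℚ ≡ x
      cancel = solve-∀ ℚ-ring

    poly-eval : ∀ {T F} x → PolyBelow C T F → Below C T (F x)
    poly-eval {zero}  x F≡0 = below-ext C (λ y → sym (F≡0 x y)) (below-zero C 0)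
    poly-eval {suc T} x (p , F₁ , bp , bF₁ , F≡) = below-ext C (λ y → sym (F≡ x y))
      (below-+ C bp (below-suc C (below-* C x (poly-eval x bF₁))))

  -- Degree of the multilinear polynomial that represents `p`: the second component is the
  -- coefficient of the first coordinate, so its degree must be one lower. At `T` = 0 `pred` stays
  -- at 0, which is right because only the zero function is allowed there.
  MultilinearBelow : ∀ s → ℕ → (Cube s → ℚ) → Set
  MultilinearBelow zero    zero    p = p [] ≡ 0ℚ
  MultilinearBelow zero    (suc T) p = ⊤
  MultilinearBelow (suc s) T       p =
    MultilinearBelow s T (λ z → p (false ∷ z)) ×
    MultilinearBelow s (pred T) (λ z → p (true ∷ z) - p (false ∷ z))

  private
    ml-ext : ∀ s {T p q} → (∀ z → p z ≡ q z) → MultilinearBelow s T p → MultilinearBelow s T q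
    ml-ext zero    {zero}  eq p≡0       = trans (sym (eq [])) p≡0
    ml-ext zero    {suc T} eq _         = tt
    ml-ext (suc s) {T}     eq (b₀ , b₁) =
      ml-ext s {T} (λ z → eq (false ∷ z)) b₀ ,
      ml-ext s {pred T} (λ z → cong₂ _-_ (eq (true ∷ z)) (eq (false ∷ z))) b₁

    ml-zero : ∀ s T → MultilinearBelow s T (λ _ → 0ℚ)
    ml-zero zero    zero    = refl
    ml-zero zero    (suc T) = tt
    ml-zero (suc s) T       = ml-zero s T , ml-ext s {pred T} (λ _ → sym (+-inverseʳ 0ℚ)) (ml-zero s (pred T))

    zero-ml : ∀ s {p} → MultilinearBelow s 0 p → ∀ z → p z ≡ 0ℚ
    zero-ml zero        p≡0       []          = p≡0
    zero-ml (suc s)     (b₀ , b₁) (false ∷ z) = zero-ml s b₀ z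
    zero-ml (suc s) {p} (b₀ , b₁) (true ∷ z)  = trans (split (p (true ∷ z)) (p (false ∷ z)))
      (cong₂ _+_ (zero-ml s b₁ z) (zero-ml s b₀ z))
      where
      split : ∀ a b → a ≡ (a - b) + b
      split = solve-∀ ℚ-ring

    ml-+ : ∀ s {T p q} → MultilinearBelow s T p → MultilinearBelow s T q →
      MultilinearBelow s T (λ z → p z + q z)
    ml-+ zero    {zero}  p≡0 q≡0 = trans (cong₂ _+_ p≡0 q≡0) (+-identityˡ 0ℚ)
    ml-+ zero    {suc T} _   _   = tt
    ml-+ (suc s) {T} {p} {q} (b₀ , b₁) (c₀ , c₁) = ml-+ s {T} b₀ c₀ ,
      ml-ext s {pred T} (λ z → regroup (p (true ∷ z)) (p (false ∷ z)) (q (true ∷ z)) (q (false ∷ z)))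
        (ml-+ s {pred T} b₁ c₁)
      where
      regroup : ∀ a b c d → (a - b) + (c - d) ≡ (a + c) - (b + d)
      regroup = solve-∀ ℚ-ring

    ml-* : ∀ s {T p} c → MultilinearBelow s T p → MultilinearBelow s T (λ z → c * p z)
    ml-* zero    {zero}  c p≡0 = trans (cong (c *_) p≡0) (*-zeroʳ c)
    ml-* zero    {suc T} c _   = tt
    ml-* (suc s) {T} {p} c (b₀ , b₁) = ml-* s {T} c b₀ ,
      ml-ext s {pred T} (λ z → distrib c (p (true ∷ z)) (p (false ∷ z))) (ml-* s {pred T} c b₁)
      where
      distrib : ∀ c a b → c * (a - b) ≡ c * a - c * b
      distrib = solve-∀ ℚ-ring

    ml-suc : ∀ s {T p} → MultilinearBelow s T p → MultilinearBelow s (suc T) p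
    ml-suc zero            _         = tt
    ml-suc (suc s) {zero}  (b₀ , b₁) = ml-suc s {0} b₀ , b₁
    ml-suc (suc s) {suc T} (b₀ , b₁) = ml-suc s {suc T} b₀ , ml-suc s {T} b₁

  multilinear : ∀ s → Filtration (Cube s)
  multilinear s = record
    { Below      = MultilinearBelow s
    ; below-ext  = λ {T} → ml-ext s {T}
    ; below-zero = ml-zero s
    ; zero-below = zero-ml s
    ; below-+    = λ {T} → ml-+ s {T}
    ; below-*    = λ {T} → ml-* s {T}
    ; below-suc  = λ {T} → ml-suc s {T}
    }

  poly-coordinate : ∀ s {T G} → PolyBelow (multilinear (suc s)) T G →
    PolyBelow (multilinear s) T (λ x z → G x (false ∷ z)) ×
    PolyBelow (multilinear s) (pred T) (λ x z → G x (true ∷ z) - G x (false ∷ z))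
  poly-coordinate s {zero} {G} G≡0 = (λ x z → G≡0 x (false ∷ z)) ,
    λ x z → trans (cong₂ _-_ (G≡0 x (true ∷ z)) (G≡0 x (false ∷ z))) (+-inverseʳ 0ℚ)
  poly-coordinate s {suc T} {G} (p , G₁ , (bp₀ , bp₁) , bG₁ , G≡) =
    (_ , _ , bp₀ , proj₁ (poly-coordinate s bG₁) , λ x z → G≡ x (false ∷ z)) ,
    poly-ext C (λ x z → sym (trans (cong₂ _-_ (G≡ x (true ∷ z)) (G≡ x (false ∷ z)))
                 (regroup (p (true ∷ z)) (p (false ∷ z)) x (G₁ x (true ∷ z)) (G₁ x (false ∷ z)))))
      (poly-+ C (poly-const C bp₁) (poly-X C (proj₂ (poly-coordinate s bG₁))))
    where
    C = multilinear s
    regroup : ∀ a b x f g → (a + x * f) - (b + x * g) ≡ (a - b) + x * (f - g)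
    regroup = solve-∀ ℚ-ring

  -- Univariate polynomials, with constants realised as functions on the one-point cube.
  Poly : ℕ → (ℚ → ℚ) → Set
  Poly T q = PolyBelow (multilinear 0) T (λ x _ → q x)

  univariate : Filtration ℚ
  univariate = record
    { Below      = Poly
    ; below-ext  = λ eq → poly-ext (multilinear 0) (λ x _ → eq x)
    ; below-zero = poly-zero (multilinear 0)
    ; zero-below = λ q≡0 x → q≡0 x []
    ; below-+    = poly-+ (multilinear 0)
    ; below-*    = poly-* (multilinear 0)
    ; below-suc  = poly-suc (multilinear 0)
    }

  poly-one : Poly 1 (λ _ → 1ℚ)
  poly-one = poly-const (multilinear 0) tt

  poly-*-linear : ∀ {T q} c → Poly T q → Poly (suc T) (λ x → q x * (x + c))
  poly-*-linear {q = q} c bq = below-ext univariate (λ x → expand (q x) x c)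
    (poly-+ (multilinear 0) (poly-X (multilinear 0) bq) (poly-suc (multilinear 0) (poly-* (multilinear 0) c bq)))
    where
    expand : ∀ a x c → x * a + c * a ≡ a * (x + c)
    expand = solve-∀ ℚ-ring

  -- One more than the sharp bound S + T - 1. In `moment-nonneg` nothing is lost, since the degree
  -- allowed there has the parity that makes both bounds equivalent.
  poly-product : ∀ {S T p q} → Poly S p → Poly T q → Poly (S ℕ.+ T) (λ x → p x * q x)
  poly-product {zero} {T} {p} {q} p≡0 bq = below-ext univariate
    (λ x → sym (trans (cong (_* q x) (p≡0 x [])) (*-zeroˡ (q x)))) (below-zero univariate T)
  poly-product {suc S} {T} {p} {q} (c , p₁ , _ , bp₁ , p≡) bq = below-ext univariate
    (λ x → sym (trans (cong (_* q x) (p≡ x [])) (expand (c []) x (p₁ x []) (q x))))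
    (poly-+ U (poly-* U (c []) (below-≤ univariate (ℕP.m≤n+m T (suc S)) bq))
      (poly-X U (poly-product {p = λ x → p₁ x []} (poly-ext U (λ { x [] → refl }) bp₁) bq)))
    where
    U = multilinear 0
    expand : ∀ a x f g → (a + x * f) * g ≡ a * g + x * (f * g)
    expand = solve-∀ ℚ-ring

  poly-reflect : ∀ {T q} → Poly T q → Poly T (λ x → q (- x))
  poly-reflect {zero}  q≡0 x = q≡0 (- x)
  poly-reflect {suc T} (c , q₁ , bc , bq₁ , q≡) = c , _ , bc ,
    poly-* U (- 1ℚ) (poly-reflect {q = λ x → q₁ x []} (poly-ext U (λ { x [] → refl }) bq₁)) ,
    λ { x [] → trans (q≡ (- x) []) (flip (c []) x (q₁ (- x) [])) }
    where
    U = multilinear 0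
    flip : ∀ a x f → a + - x * f ≡ a + x * (- 1ℚ * f)
    flip = solve-∀ ℚ-ring

  -- Each difference lowers the degree by one, and after r of them only the zero polynomial is left.
  altSum-poly : ∀ r {q} c → Poly r q → altSum r (λ k → q (c + ι k)) ≡ 0ℚ
  altSum-poly zero    c q≡0 = trans (*-identityˡ _) (q≡0 _ [])
  altSum-poly (suc r) {q} c bq = begin
    altSum (suc r) (λ k → q (c + ι k))
      ≡⟨ altSum-difference r _ ⟩
    - altSum r (λ k → q (c + (1ℚ + ι k)) - q (c + ι k))
      ≡⟨ cong -_ (altSum-cong r (λ k → cong (λ z → q z - q (c + ι k)) (regroup c (ι k)))) ⟩
    - altSum r (λ k → q (c + ι k + 1ℚ) - q (c + ι k))
      ≡⟨ cong -_ (altSum-poly r c (poly-difference (multilinear 0) bq)) ⟩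
    - 0ℚ ∎
    where
    open ≡-Reasoning
    regroup : ∀ c i → c + (1ℚ + i) ≡ c + i + 1ℚ
    regroup = solve-∀ ℚ-ring

  -- The bound concerns the total degree: r differences in the first variable leave total degree
  -- below s, and then s differences in the second variable annihilate what remains.
  altSum-bipoly : ∀ r s {F} c → PolyBelow univariate (r ℕ.+ s) F →
    altSum r (λ k → altSum s (λ i → F (ι k) (c + ι i))) ≡ 0ℚ
  altSum-bipoly zero    s c bF = trans (*-identityˡ _) (altSum-poly s c (poly-eval univariate 0ℚ bF))
  altSum-bipoly (suc r) s {F} c bF = begin
    altSum (suc r) (λ k → inner (ι k))
      ≡⟨ altSum-difference r _ ⟩
    - altSum r (λ k → inner (1ℚ + ι k) - inner (ι k))
      ≡⟨ cong -_ (altSum-cong r (λ k → trans (cong (λ z → inner z - inner (ι k)) (+-comm 1ℚ (ι k)))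
                                             (sym (altSum-- s _ _)))) ⟩
    - altSum r (λ k → altSum s (λ i → F (ι k + 1ℚ) (c + ι i) - F (ι k) (c + ι i)))
      ≡⟨ cong -_ (altSum-bipoly r s c (poly-difference univariate bF)) ⟩
    - 0ℚ ∎
    where
    open ≡-Reasoning
    inner : ℚ → ℚ
    inner x = altSum s (λ i → F x (c + ι i))

  -- `F` is (h(x) - h(-y)) / (x + y). It is built by Horner's recursion from h = c + x h₁ rather
  -- than by division, so that the bound on its total degree can be read off.
  divided-difference : ∀ {T h} → Poly (suc T) h →
    ∃[ F ] (PolyBelow univariate T F × (∀ x y → h x ≡ h (- y) + (x + y) * F x y))
  divided-difference {zero} {h} (c , h₁ , _ , h₁≡0 , h≡) = (λ _ _ → 0ℚ) , (λ _ _ → refl) , λ x y →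
    trans (h≡c x) (trans (expand (c []) (x + y)) (cong (_+ (x + y) * 0ℚ) (sym (h≡c (- y)))))
    where
    h≡c : ∀ x → h x ≡ c []
    h≡c x = trans (h≡ x []) (trans (cong (λ z → c [] + x * z) (h₁≡0 x [])) (sym (expand (c []) x)))
      where
      expand : ∀ a x → a ≡ a + x * 0ℚ
      expand = solve-∀ ℚ-ring
    expand : ∀ a x → a ≡ a + x * 0ℚ
    expand = solve-∀ ℚ-ring
  divided-difference {suc T} {h} (c , h₁ , _ , bh₁ , h≡) =
    let bq = poly-ext (multilinear 0) (λ { x [] → refl }) bh₁
        (F , bF , q≡) = divided-difference {h = λ x → h₁ x []} bq
    in (λ x y → h₁ (- y) [] + x * F x y) , (_ , F , poly-reflect bq , bF , λ _ _ → refl) , λ x y →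
       trans (h≡ x []) (trans (cong (λ z → c [] + x * z) (q≡ x y))
         (trans (regroup (c []) x y (h₁ (- y) []) (F x y))
                (cong (_+ (x + y) * (h₁ (- y) [] + x * F x y)) (sym (h≡ (- y) [])))))
    where
    regroup : ∀ a x y b f →
      a + x * (b + (x + y) * f) ≡ (a + - y * b) + (x + y) * (b + x * f)
    regroup = solve-∀ ℚ-ring

  -- Reduction of symmetric forms on the cube to one variable

  cubeSum : ∀ s → (Cube s → ℚ) → ℚ
  cubeSum zero    F = F []
  cubeSum (suc s) F = cubeSum s (λ z → F (false ∷ z)) + cubeSum s (λ z → F (true ∷ z))

  cubeSum-cong : ∀ s {F G} → (∀ z → F z ≡ G z) → cubeSum s F ≡ cubeSum s G
  cubeSum-cong zero    eq = eq []
  cubeSum-cong (suc s) eq = cong₂ _+_ (cubeSum-cong s (λ z → eq (false ∷ z))) (cubeSum-cong s (λ z → eq (true ∷ z)))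

  cubeSum-+ : ∀ s F G → cubeSum s (λ z → F z + G z) ≡ cubeSum s F + cubeSum s G
  cubeSum-+ zero    F G = refl
  cubeSum-+ (suc s) F G = trans (cong₂ _+_ (cubeSum-+ s _ _) (cubeSum-+ s _ _))
    (+-interchange (cubeSum s (λ z → F (false ∷ z))) (cubeSum s (λ z → G (false ∷ z)))
                   (cubeSum s (λ z → F (true ∷ z))) (cubeSum s (λ z → G (true ∷ z))))

  cubeSum-* : ∀ s c F → cubeSum s (λ z → c * F z) ≡ c * cubeSum s F
  cubeSum-* zero    c F = refl
  cubeSum-* (suc s) c F = trans (cong₂ _+_ (cubeSum-* s c _) (cubeSum-* s c _))
    (sym (*-distribˡ-+ c (cubeSum s (λ z → F (false ∷ z))) (cubeSum s (λ z → F (true ∷ z)))))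

  cubeSum-symmetric : ∀ s φ → cubeSum s (λ z → φ ‖ z ‖₁) ≡ binSum s φ
  cubeSum-symmetric zero    φ = refl
  cubeSum-symmetric (suc s) φ = cong₂ _+_ (cubeSum-symmetric s φ) (cubeSum-symmetric s (φ ∘ suc))

  -- A quadratic form on functions of r+s bits that are symmetric in the first r of them;
  -- such a function is given by G(k,z), where k is the number of ones among the first r bits.
  symForm : ∀ r s → (ℕ → ℚ) → (ℚ → Cube s → ℚ) → ℚ
  symForm r s Y G = cubeSum s λ z → binSum r λ k → Y (‖ z ‖₁ ℕ.+ k) * (G (ι k) z * G (ι k) z)

  -- The univariate conditions that symmetrisation leaves. Here j counts the pairs of coordinates
  -- split off; each pair uses up two variables, raises the level by one, as one of its two bits is
  -- 1, and lowers the degree by one.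
  PositiveOn : (ℕ → ℚ) → ℕ → ℕ → Set
  PositiveOn Y N T = ∀ j r → r ℕ.+ (j ℕ.+ j) ≡ N → ∀ q → Poly (T ℕ.∸ j) q →
    0ℚ ≤ binSum r (λ k → Y (j ℕ.+ k) * (q (ι k) * q (ι k)))

  positiveOn-suc : ∀ Y N T → PositiveOn Y (suc (suc N)) T → PositiveOn (Y ∘ suc) N (pred T)
  positiveOn-suc Y N T pos j r eq q bq = pos (suc j) r
    (trans (ℕP.+-suc r (j ℕ.+ suc j))
           (cong suc (trans (cong (r ℕ.+_) (ℕP.+-suc j j)) (trans (ℕP.+-suc r (j ℕ.+ j)) (cong suc eq)))))
    q (subst (λ S → Poly S q) (pred-∸ T) bq)
    where
    pred-∸ : ∀ T → pred T ℕ.∸ j ≡ T ℕ.∸ suc j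
    pred-∸ zero    = ℕP.0∸n≡0 j
    pred-∸ (suc T) = refl

  -- Symmetrising over one more bit: A and B are the values at 0 and 1 of that bit, and the pointwise
  -- identity is R((R-k)a² + kb²) = ((R-k)a + kb)² + k(R-k)(a-b)².
  symmetrise : ∀ r (y A B : ℕ → ℚ) → let R = ι (suc r) in
    R * R * (binSum r (λ k → y k * (A k * A k)) + binSum r (λ k → y (suc k) * (B (suc k) * B (suc k)))) ≡
    binSum (suc r) (λ k → y k * (((R - ι k) * A k + ι k * B k) * ((R - ι k) * A k + ι k * B k))) +
    binSum (suc r) (λ k → ι k * ((R - ι k) * (y k * ((A k - B k) * (A k - B k)))))
  symmetrise r y A B = begin
    R * R * (binSum r α + binSum r (β ∘ suc))
      ≡⟨ distrib R (binSum r α) (binSum r (β ∘ suc)) ⟩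
    R * (R * binSum r α + R * binSum r (β ∘ suc))
      ≡⟨ cong (R *_) (cong₂ _+_ (binSum-absorb′ r α) (binSum-absorb r β)) ⟨
    R * (binSum (suc r) (λ k → (R - ι k) * α k) + binSum (suc r) (λ k → ι k * β k))
      ≡⟨ cong (R *_) (binSum-+ (suc r) _ _) ⟨
    R * binSum (suc r) (λ k → (R - ι k) * α k + ι k * β k)
      ≡⟨ binSum-* (suc r) R _ ⟨
    binSum (suc r) (λ k → R * ((R - ι k) * α k + ι k * β k))
      ≡⟨ binSum-cong (suc r) (λ k → pointwise R (ι k) (y k) (A k) (B k)) ⟩
    binSum (suc r) (λ k → y k * (((R - ι k) * A k + ι k * B k) * ((R - ι k) * A k + ι k * B k)) +
                          ι k * ((R - ι k) * (y k * ((A k - B k) * (A k - B k)))))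
      ≡⟨ binSum-+ (suc r) _ _ ⟩
    _ ∎
    where
    open ≡-Reasoning
    R = ι (suc r)
    α β : ℕ → ℚ
    α k = y k * (A k * A k)
    β k = y k * (B k * B k)
    distrib : ∀ R a b → R * R * (a + b) ≡ R * (R * a + R * b)
    distrib = solve-∀ ℚ-ring
    pointwise : ∀ R k y a b → R * ((R - k) * (y * (a * a)) + k * (y * (b * b))) ≡
      y * (((R - k) * a + k * b) * ((R - k) * a + k * b)) +
      k * ((R - k) * (y * ((a - b) * (a - b))))
    pointwise = solve-∀ ℚ-ring

  -- With R = r + 2, the factor k(R-k) vanishes on the two extreme levels and turns C(R,k) into
  -- R(R-1) C(R-2,k-1), so the sum lives on two bits fewer and one level up.
  antisymmetric-part : ∀ r χ →
    binSum (2 ℕ.+ r) (λ k → ι k * ((ι (2 ℕ.+ r) - ι k) * χ k)) ≡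
    ι (2 ℕ.+ r) * ι (1 ℕ.+ r) * binSum r (χ ∘ suc)
  antisymmetric-part r χ = begin
    binSum (2 ℕ.+ r) (λ k → ι k * ((ι (2 ℕ.+ r) - ι k) * χ k))
      ≡⟨ binSum-absorb (suc r) _ ⟩
    ι (2 ℕ.+ r) * binSum (suc r) (λ k → (ι (2 ℕ.+ r) - ι (suc k)) * χ (suc k))
      ≡⟨ cong (ι (2 ℕ.+ r) *_) (binSum-cong (suc r) (λ k → cong (_* χ (suc k)) (cancel (ι (suc r)) (ι k)))) ⟩
    ι (2 ℕ.+ r) * binSum (suc r) (λ k → (ι (suc r) - ι k) * χ (suc k))
      ≡⟨ cong (ι (2 ℕ.+ r) *_) (binSum-absorb′ r (χ ∘ suc)) ⟩
    ι (2 ℕ.+ r) * (ι (1 ℕ.+ r) * binSum r (χ ∘ suc))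
      ≡⟨ *-assoc (ι (2 ℕ.+ r)) (ι (1 ℕ.+ r)) (binSum r (χ ∘ suc)) ⟨
    ι (2 ℕ.+ r) * ι (1 ℕ.+ r) * binSum r (χ ∘ suc) ∎
    where
    open ≡-Reasoning
    cancel : ∀ a b → (1ℚ + a) - (1ℚ + b) ≡ a - b
    cancel = solve-∀ ℚ-ring

  -- Induction on the number `s` of bits not yet symmetrised. By `symmetrise` the form splits in
  -- two: the first part has one more symmetric bit, the second has lost two bits and one degree.
  -- The factor R² avoids dividing by the number of bits.
  symForm-nonneg : ∀ s r Y {T G} → PolyBelow (multilinear s) T G →
    PositiveOn Y (r ℕ.+ s) T → 0ℚ ≤ symForm r s Y G
  symForm-nonneg zero r Y {G = G} bG pos =
    pos 0 r refl (λ x → G x []) (poly-ext (multilinear 0) (λ { x [] → refl }) bG)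
  symForm-nonneg (suc s) r Y {T} {G} bG pos =
    *-cancel-nonneg (*-pos (ι-pos r) (ι-pos r)) (subst (0ℚ ≤_) (sym decomposition)
      (+-nonneg (symForm-nonneg s (suc r) Y bS (subst (λ N → PositiveOn Y N T) (ℕP.+-suc r s) pos))
                (anti r pos)))
    where
    C = multilinear s
    R = ι (suc r)
    G₀ G₁ S : ℚ → Cube s → ℚ
    G₀ x z = G x (false ∷ z)
    G₁ x z = G x (true ∷ z)
    -- R times the average of `G` over the choice of the bit singled out among the R bits. Here x
    -- counts the ones among all R bits, so `G₁`, whose argument omits the singled-out one, is taken
    -- at x - 1.
    S x z = (R - x) * G₀ x z + x * G₁ (x - 1ℚ) z
    y : Cube s → ℕ → ℚ
    y z k = Y (‖ z ‖₁ ℕ.+ k)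
    χ : Cube s → ℕ → ℚ
    χ z k = y z k * ((G₀ (ι k) z - G₁ (ι k - 1ℚ) z) * (G₀ (ι k) z - G₁ (ι k - 1ℚ) z))

    bG₀ : PolyBelow C T G₀
    bG₀ = proj₁ (poly-coordinate s bG)
    bG₁-G₀ : PolyBelow C (pred T) (λ x z → G₁ x z - G₀ x z)
    bG₁-G₀ = proj₂ (poly-coordinate s bG)

    -- `S` is R G₀(x) + x (G₁(x-1) - G₀(x)). The bracket has lower degree, being a slope in the
    -- split bit minus a backward difference, so the factor x does not raise the degree.
    bS : PolyBelow C T S
    bS = poly-ext C (λ x z → regroup R x (G₀ x z) (G₀ (x - 1ℚ) z) (G₁ (x - 1ℚ) z))
      (poly-+ C (poly-* C R bG₀)
                (poly-X C (poly-- C (poly-shift C (- 1ℚ) bG₁-G₀) (poly-backward-difference C bG₀))))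
      where
      regroup : ∀ R x a a′ b → R * a + x * ((b - a′) - (a - a′)) ≡ (R - x) * a + x * b
      regroup = solve-∀ ℚ-ring

    bH : PolyBelow C (pred T) (λ x z → (G₀ (x + 1ℚ) z - G₀ x z) - (G₁ x z - G₀ x z))
    bH = poly-- C (poly-difference C bG₀) bG₁-G₀

    cancel : ∀ x → 1ℚ + x - 1ℚ ≡ x
    cancel = solve-∀ ℚ-ring

    decomposition : R * R * symForm r (suc s) Y G ≡ symForm (suc r) s Y S +
      cubeSum s (λ z → binSum (suc r) (λ k → ι k * ((R - ι k) * χ z k)))
    decomposition = trans (cong (R * R *_) (sym (cubeSum-+ s _ _)))
      (trans (sym (cubeSum-* s (R * R) _))
      (trans (cubeSum-cong s (λ z → trans
          (cong (λ w → R * R * (binSum r (λ k → y z k * (G₀ (ι k) z * G₀ (ι k) z)) + w))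
            (binSum-cong r (λ k → cong₂ (λ j x → Y j * (G₁ x z * G₁ x z))
              (sym (ℕP.+-suc ‖ z ‖₁ k)) (sym (cancel (ι k))))))
          (symmetrise r (y z) (λ k → G₀ (ι k) z) (λ k → G₁ (ι k - 1ℚ) z))))
        (cubeSum-+ s _ _)))

    anti : ∀ r → PositiveOn Y (r ℕ.+ suc s) T →
      0ℚ ≤ cubeSum s (λ z → binSum (suc r) (λ k → ι k * ((ι (suc r) - ι k) * χ z k)))
    -- With R = 1 the factor k(R-k) is zero at both k = 0 and k = 1.
    anti zero    pos = ≤-reflexive (sym (trans
      (cubeSum-cong s (λ z → trans (vanish (χ z 0) (χ z 1)) (sym (*-zeroˡ 0ℚ))))
      (trans (cubeSum-* s 0ℚ (λ _ → 0ℚ)) (*-zeroˡ (cubeSum s (λ _ → 0ℚ))))))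
      where
      vanish : ∀ a b → 0ℚ * ((1ℚ + 0ℚ - 0ℚ) * a) + (1ℚ + 0ℚ) * ((1ℚ + 0ℚ - (1ℚ + 0ℚ)) * b) ≡ 0ℚ
      vanish = solve-∀ ℚ-ring
    anti (suc r) pos = subst (0ℚ ≤_)
      (sym (trans (cubeSum-cong s (λ z → trans (antisymmetric-part r (χ z))
                    (cong (ι (2 ℕ.+ r) * ι (1 ℕ.+ r) *_) (binSum-cong r (λ k → pointwise z k)))))
                  (cubeSum-* s (ι (2 ℕ.+ r) * ι (1 ℕ.+ r)) _)))
      (*-nonneg (<⇒≤ (*-pos (ι-pos (suc r)) (ι-pos r)))
        (symForm-nonneg s r (Y ∘ suc) bH (positiveOn-suc Y (r ℕ.+ s) T
          (subst (λ N → PositiveOn Y N T) (cong suc (ℕP.+-suc r s)) pos))))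
      where
      pointwise : ∀ z k → χ z (suc k) ≡ Y (suc (‖ z ‖₁ ℕ.+ k)) *
        (((G₀ (ι k + 1ℚ) z - G₀ (ι k) z) - (G₁ (ι k) z - G₀ (ι k) z)) *
         ((G₀ (ι k + 1ℚ) z - G₀ (ι k) z) - (G₁ (ι k) z - G₀ (ι k) z)))
      pointwise z k = cong₂ (λ j g → Y j * (g * g)) (ℕP.+-suc ‖ z ‖₁ k)
        (trans (cong₂ (λ x x′ → G₀ x z - G₁ x′ z) (+-comm 1ℚ (ι k)) (cancel (ι k)))
               (regroup (G₀ (ι k + 1ℚ) z) (G₀ (ι k) z) (G₁ (ι k) z)))
        where
        regroup : ∀ a b c → a - c ≡ (a - b) - (c - b)
        regroup = solve-∀ ℚ-ring

  cubeForm-nonneg : ∀ n Y {T p} → MultilinearBelow n T p → PositiveOn Y n T →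
    0ℚ ≤ cubeSum n (λ z → Y ‖ z ‖₁ * (p z * p z))
  cubeForm-nonneg n Y {p = p} bp pos = subst (0ℚ ≤_)
    (cubeSum-cong n (λ z → cong (λ j → Y j * (p z * p z)) (ℕP.+-identityʳ ‖ z ‖₁)))
    (symForm-nonneg n 0 Y (poly-const (multilinear n) bp) pos)

  -- The pseudo-moments and their positivity

  -- Weaker than the name suggests: only 0, -1, -2, ... are excluded, the points where a denominator
  -- u + k vanishes.
  NonInteger : ℚ → Set
  NonInteger u = ∀ k → u + ι k ≢ 0ℚ

  -- r! / (u (u+1) ⋯ (u+r)), by partial fractions.
  recipDiff : ℕ → ℚ → ℚ
  recipDiff r u = altSum r (λ k → recip (u + ι k))

  -- Cancels the first factor of the product u (u+1) ⋯. Since (u+k) · `recip` (u+k) is constantly 1,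
  -- its difference of positive order vanishes, and `altSum-linear` expands this difference.
  -- `recipDiff-upper` cancels the last factor in the same way.
  recipDiff-lower : ∀ r u → NonInteger u →
    u * recipDiff (suc r) u ≡ ι (suc r) * recipDiff r (u + 1ℚ)
  recipDiff-lower r u u≢0 = begin
    u * recipDiff (suc r) u
      ≡⟨ isolate (u * recipDiff (suc r) u) (R * w) ⟩
    (u * recipDiff (suc r) u - R * w) + R * w
      ≡⟨ cong (_+ R * w) (trans (sym (altSum-linear r u _))
           (altSum-const r (λ k → trans (recip-inverse (u≢0 (suc k))) (sym (recip-inverse (u≢0 k)))))) ⟩
    0ℚ + R * w
      ≡⟨ +-identityˡ (R * w) ⟩
    R * w
      ≡⟨ cong (R *_) (altSum-cong r (λ k → cong recip (sym (+-assoc u 1ℚ (ι k))))) ⟩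
    R * recipDiff r (u + 1ℚ) ∎
    where
    open ≡-Reasoning
    R = ι (suc r)
    w = altSum r (λ k → recip (u + (1ℚ + ι k)))
    isolate : ∀ a b → a ≡ (a - b) + b
    isolate = solve-∀ ℚ-ring

  recipDiff-upper : ∀ r u → NonInteger u →
    (u + ι (suc r)) * recipDiff (suc r) u ≡ ι (suc r) * recipDiff r u
  recipDiff-upper r u u≢0 = begin
    a
      ≡⟨ isolate a b ⟩
    (a - b) + b
      ≡⟨ cong (_+ b) (trans (sym (altSum-linear′ r u _))
           (altSum-const r (λ k → trans (recip-inverse (u≢0 (suc k))) (sym (recip-inverse (u≢0 k)))))) ⟩
    0ℚ + b
      ≡⟨ +-identityˡ b ⟩
    b ∎
    where
    open ≡-Reasoning
    a = (u + ι (suc r)) * recipDiff (suc r) u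
    b = ι (suc r) * recipDiff r u
    isolate : ∀ a b → a ≡ (a - b) + b
    isolate = solve-∀ ℚ-ring

  recipDiff-pos : ∀ r {u} → 0ℚ < u → 0ℚ < recipDiff r u
  recipDiff-pos zero    {u} 0<u = subst (0ℚ <_) (sym (*-identityˡ (recip (u + 0ℚ))))
    (recip-pos (+-pos-nonneg 0<u (≤-refl {0ℚ})))
  recipDiff-pos (suc r) {u} 0<u = *-cancel-pos 0<u (subst (0ℚ <_)
    (sym (recipDiff-lower r u (λ k eq → <-irrefl (sym eq) (+-pos-nonneg 0<u (ι-nonneg k)))))
    (*-pos (ι-pos r) (recipDiff-pos r (+-pos-nonneg 0<u (nonNegative⁻¹ 1ℚ)))))

  -- At u = ½ - l with l ≤ r + 1, exactly l of the factors u, ..., u + r are negative. The induction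
  -- strips off the first of them.
  recipDiff-sign : ∀ r l → l ℕ.≤ suc r → 0ℚ < sgn l * recipDiff r (½ - ι l)
  recipDiff-sign r zero _ = subst (0ℚ <_) (sym (*-identityˡ (recipDiff r (½ - 0ℚ))))
    (recipDiff-pos r (positive⁻¹ (½ - 0ℚ)))
  recipDiff-sign zero (suc zero) _ = toWitness {a? = 0ℚ <? sgn 1 * recipDiff 0 (½ - ι 1)} _
  recipDiff-sign zero (suc (suc l)) (s≤s ())
  recipDiff-sign (suc r) (suc l) (s≤s l≤) = *-cancel-pos
    (difference-pos (<-≤-trans (toWitness {a? = ½ <? 1ℚ} _) (ι-mono-≤ {1} {suc l} (s≤s z≤n))))
    (subst (0ℚ <_) (sym eq) (*-pos (ι-pos r) (recipDiff-sign r l l≤)))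
    where
    open ≡-Reasoning
    u = ½ - ι (suc l)
    flip : ∀ i s v → (1ℚ + i - ½) * (- s * v) ≡ s * ((½ - (1ℚ + i)) * v)
    flip = solve-∀ ℚ-ring
    commute : ∀ s R v → s * (R * v) ≡ R * (s * v)
    commute = solve-∀ ℚ-ring
    raise : ∀ i → ½ - (1ℚ + i) + 1ℚ ≡ ½ - i
    raise = solve-∀ ℚ-ring
    eq : (ι (suc l) - ½) * (sgn (suc l) * recipDiff (suc r) u) ≡
         ι (suc r) * (sgn l * recipDiff r (½ - ι l))
    eq = begin
      (ι (suc l) - ½) * (sgn (suc l) * recipDiff (suc r) u)
        ≡⟨ flip (ι l) (sgn l) (recipDiff (suc r) u) ⟩
      sgn l * (u * recipDiff (suc r) u)
        ≡⟨ cong (sgn l *_) (recipDiff-lower r u (½-ι+ι≢0 (suc l))) ⟩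
      sgn l * (ι (suc r) * recipDiff r (u + 1ℚ))
        ≡⟨ cong (λ z → sgn l * (ι (suc r) * recipDiff r z)) (raise (ι l)) ⟩
      sgn l * (ι (suc r) * recipDiff r (½ - ι l))
        ≡⟨ commute (sgn l) (ι (suc r)) (recipDiff r (½ - ι l)) ⟩
      ι (suc r) * (sgn l * recipDiff r (½ - ι l)) ∎

  -- Since h(x)/(x+y) = h(-y)/(x+y) + (a polynomial of degree < r+a), the double difference, of order r in x
  -- and a in y, of h(x)/(x+y) only sees the first summand: it is a sum over the poles.
  exchange : ∀ r a γ {h} → NonInteger γ → Poly (suc (r ℕ.+ a)) h →
    altSum r (λ k → h (ι k) * recipDiff a (γ + ι k)) ≡
    altSum a (λ i → h (- (γ + ι i)) * recipDiff r (γ + ι i))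
  exchange r a γ {h} γ≢0 bh = begin
    altSum r (λ k → h (ι k) * recipDiff a (γ + ι k))
      ≡⟨ altSum-cong r (λ k → altSum-* a (h (ι k)) _) ⟨
    altSum r (λ k → altSum a (λ i → h (ι k) * recip (γ + ι k + ι i)))
      ≡⟨ altSum-cong r (λ k → altSum-cong a (divide k)) ⟩
    altSum r (λ k → altSum a (λ i → polar k i + F (ι k) (γ + ι i)))
      ≡⟨ altSum-cong r (λ k → altSum-+ a _ _) ⟩
    altSum r (λ k → altSum a (polar k) + altSum a (λ i → F (ι k) (γ + ι i)))
      ≡⟨ altSum-+ r _ _ ⟩
    altSum r (λ k → altSum a (polar k)) + altSum r (λ k → altSum a (λ i → F (ι k) (γ + ι i)))
      ≡⟨ cong₂ _+_ (altSum-swap r a polar) (altSum-bipoly r a γ bF) ⟩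
    altSum a (λ i → altSum r (λ k → polar k i)) + 0ℚ
      ≡⟨ +-identityʳ _ ⟩
    altSum a (λ i → altSum r (λ k → polar k i))
      ≡⟨ altSum-cong a (λ i → altSum-* r (h (- (γ + ι i))) _) ⟩
    altSum a (λ i → h (- (γ + ι i)) * recipDiff r (γ + ι i)) ∎
    where
    open ≡-Reasoning
    F = proj₁ (divided-difference bh)
    bF = proj₁ (proj₂ (divided-difference bh))
    h≡ = proj₂ (proj₂ (divided-difference bh))
    polar : ℕ → ℕ → ℚ
    polar k i = h (- (γ + ι i)) * recip (γ + ι i + ι k)
    divide : ∀ k i → h (ι k) * recip (γ + ι k + ι i) ≡ polar k i + F (ι k) (γ + ι i)
    divide k i = begin
      h (ι k) * recip (γ + ι k + ι i)
        ≡⟨ cong₂ _*_ (h≡ (ι k) (γ + ι i)) (cong recip (regroup γ (ι k) (ι i))) ⟩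
      (h (- (γ + ι i)) + (ι k + (γ + ι i)) * f) * ρ
        ≡⟨ expand (h (- (γ + ι i))) (ι k) γ (ι i) f ρ ⟩
      polar k i + f * ((γ + ι i + ι k) * ρ)
        ≡⟨ cong (λ z → polar k i + f * z) (recip-inverse nonzero) ⟩
      polar k i + f * 1ℚ
        ≡⟨ cong (polar k i +_) (*-identityʳ f) ⟩
      polar k i + f ∎
      where
      f = F (ι k) (γ + ι i)
      ρ = recip (γ + ι i + ι k)
      nonzero : γ + ι i + ι k ≢ 0ℚ
      nonzero eq = γ≢0 (i ℕ.+ k) (trans (cong (γ +_) (ι-+ i k)) (trans (sym (+-assoc γ (ι i) (ι k))) eq))
      regroup : ∀ γ x i → γ + x + i ≡ γ + i + x
      regroup = solve-∀ ℚ-ring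
      expand : ∀ c x γ i f ρ → (c + (x + (γ + i)) * f) * ρ ≡ c * ρ + f * ((γ + i + x) * ρ)
      expand = solve-∀ ℚ-ring

  -- Up to the positive factor a!, this is (-1)^{L+k} / ∏_{i=0}^{a} (k - (L - ½ - i)).
  weight : ℕ → ℕ → ℕ → ℚ
  weight a L k = sgn L * sgn k * recipDiff a (½ - ι L + ι k)

  -- On the levels from L - a - 1 to L, those adjacent to the a + 1 poles, the alternating sign
  -- matches the sign of the product, by `recipDiff-sign`.
  weight-pos : ∀ a L k → k ℕ.≤ L → L ℕ.∸ k ℕ.≤ suc a → 0ℚ < weight a L k
  weight-pos a L k k≤L small = subst (0ℚ <_)
    (cong₂ (λ s u → s * recipDiff a u) (sym (sgn-∸ k≤L))
      (trans (cong (λ z → ½ - z) (ι-∸ k≤L)) (regroup (ι L) (ι k))))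
    (recipDiff-sign a (L ℕ.∸ k) small)
    where
    regroup : ∀ l k → ½ - (l - k) ≡ ½ - l + k
    regroup = solve-∀ ℚ-ring

  -- The coefficients at the poles are again weights, with r and a interchanged, so `weight-pos`
  -- decides the signs on both sides. The offset j cancels: it moves levels and poles alike, and its
  -- sign is squared.
  weight-exchange : ∀ r a L j {h} → Poly (suc (r ℕ.+ a)) h →
    binSum r (λ k → weight a (j ℕ.+ L) (j ℕ.+ k) * h (ι k)) ≡
    binSum a (λ i → weight r L i * h (- (½ - ι L + ι i)))
  weight-exchange r a L j {h} bh = begin
    binSum r (λ k → weight a (j ℕ.+ L) (j ℕ.+ k) * h (ι k))
      ≡⟨ binSum-cong r shift ⟩
    binSum r (λ k → sgn L * (sgn k * (h (ι k) * recipDiff a (½ - ι L + ι k))))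
      ≡⟨ binSum-* r (sgn L) _ ⟩
    sgn L * altSum r (λ k → h (ι k) * recipDiff a (½ - ι L + ι k))
      ≡⟨ cong (sgn L *_) (exchange r a (½ - ι L) (½-ι+ι≢0 L) bh) ⟩
    sgn L * altSum a (λ i → h (- (½ - ι L + ι i)) * recipDiff r (½ - ι L + ι i))
      ≡⟨ binSum-* a (sgn L) _ ⟨
    binSum a (λ i → sgn L * (sgn i * (h (- (½ - ι L + ι i)) * recipDiff r (½ - ι L + ι i))))
      ≡⟨ binSum-cong a (λ i → regroup (sgn L) (sgn i) (h (- (½ - ι L + ι i))) _) ⟩
    binSum a (λ i → weight r L i * h (- (½ - ι L + ι i))) ∎
    where
    open ≡-Reasoning
    regroup : ∀ s t p q → s * (t * (p * q)) ≡ s * t * q * p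
    regroup = solve-∀ ℚ-ring
    collect : ∀ s l k d p → s * l * (s * k) * d * p ≡ s * s * (l * (k * (p * d)))
    collect = solve-∀ ℚ-ring
    cancel : ∀ j l k → ½ - (j + l) + (j + k) ≡ ½ - l + k
    cancel = solve-∀ ℚ-ring
    shift : ∀ k → weight a (j ℕ.+ L) (j ℕ.+ k) * h (ι k) ≡
      sgn L * (sgn k * (h (ι k) * recipDiff a (½ - ι L + ι k)))
    shift k = begin
      sgn (j ℕ.+ L) * sgn (j ℕ.+ k) * recipDiff a (½ - ι (j ℕ.+ L) + ι (j ℕ.+ k)) * h (ι k)
        ≡⟨ cong₂ (λ s u → s * recipDiff a u * h (ι k)) (cong₂ _*_ (sgn-+ j L) (sgn-+ j k))
             (trans (cong₂ (λ p q → ½ - p + q) (ι-+ j L) (ι-+ j k)) (cancel (ι j) (ι L) (ι k))) ⟩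
      sgn j * sgn L * (sgn j * sgn k) * d * h (ι k)
        ≡⟨ collect (sgn j) (sgn L) (sgn k) d (h (ι k)) ⟩
      sgn j * sgn j * (sgn L * (sgn k * (h (ι k) * d)))
        ≡⟨ cong (_* (sgn L * (sgn k * (h (ι k) * d)))) (sgn-square j) ⟩
      1ℚ * (sgn L * (sgn k * (h (ι k) * d)))
        ≡⟨ *-identityˡ _ ⟩
      sgn L * (sgn k * (h (ι k) * d)) ∎
      where
      d = recipDiff a (½ - ι L + ι k)

  double : ℕ → ℕ
  double zero    = zero
  double (suc k) = suc (suc (double k))

  double≡+ : ∀ k → double k ≡ k ℕ.+ k
  double≡+ zero    = refl
  double≡+ (suc k) = cong suc (trans (cong suc (double≡+ k)) (sym (ℕP.+-suc k k)))

  double-+ : ∀ j k → double (j ℕ.+ k) ≡ double j ℕ.+ double k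
  double-+ zero    k = refl
  double-+ (suc j) k = cong (suc ∘ suc) (double-+ j k)

  ι-double : ∀ k → ι (double k) ≡ ι k + ι k
  ι-double k = trans (cong ι (double≡+ k)) (ι-+ k k)

  sgn-double : ∀ k → sgn (double k) ≡ 1ℚ
  sgn-double zero    = refl
  sgn-double (suc k) = trans (neg-neg (sgn (double k))) (sgn-double k)
    where
    neg-neg : ∀ p → - - p ≡ p
    neg-neg = solve-∀ ℚ-ring

  -- Throughout, e = d - 1 and m = M + e, hence n = 2m+1 = suc (double (M + e)); the poles are the
  -- half-integers between M and n - M = suc (M + double e).
  moment-nonneg : ∀ e M T → T ℕ.≤ suc (M ℕ.+ double e) →
    PositiveOn (weight (double e) (suc (M ℕ.+ double e))) (suc (double (M ℕ.+ e))) T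
  moment-nonneg e M T T≤ j r r+2j≡n q bq with ℕP.≤-total M j
  ... | inj₁ M≤j = binSum-nonneg r (λ k k≤r → *-nonneg
      (<⇒≤ (weight-pos (double e) L (j ℕ.+ k) (≤L k k≤r) (L∸≤ k))) (square-nonneg (q (ι k))))
    where
    L = suc (M ℕ.+ double e)
    L∸≤ : ∀ k → L ℕ.∸ (j ℕ.+ k) ℕ.≤ suc (double e)
    L∸≤ k = ℕP.m≤n+o⇒m∸n≤o L (j ℕ.+ k) (ℕP.≤-trans (ℕP.≤-reflexive (sym (ℕP.+-suc M (double e))))
      (ℕP.+-monoˡ-≤ (suc (double e)) (ℕP.≤-trans M≤j (ℕP.m≤m+n j k))))
    ≤L : ∀ k → k ℕ.≤ r → j ℕ.+ k ℕ.≤ L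
    ≤L k k≤r = ℕP.+-cancelˡ-≤ M _ _ (begin
      M ℕ.+ (j ℕ.+ k)      ≤⟨ ℕP.+-mono-≤ M≤j (ℕP.+-monoʳ-≤ j k≤r) ⟩
      j ℕ.+ (j ℕ.+ r)      ≡⟨ ℕP.+-assoc j j r ⟨
      j ℕ.+ j ℕ.+ r        ≡⟨ ℕP.+-comm (j ℕ.+ j) r ⟩
      r ℕ.+ (j ℕ.+ j)      ≡⟨ r+2j≡n ⟩
      suc (double (M ℕ.+ e)) ≡⟨ cong suc (trans (double-+ M e) (cong (ℕ._+ double e) (double≡+ M))) ⟩
      suc (M ℕ.+ M ℕ.+ double e) ≡⟨ cong suc (ℕP.+-assoc M M (double e)) ⟩
      suc (M ℕ.+ (M ℕ.+ double e)) ≡⟨ ℕP.+-suc M (M ℕ.+ double e) ⟨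
      M ℕ.+ L              ∎)
      where open ℕP.≤-Reasoning
  ... | inj₂ j≤M with ℕP.m≤n⇒∃[o]m+o≡n j≤M
  ... | p , refl = subst (0ℚ ≤_)
      (sym (trans (binSum-cong r (λ k → cong (λ l → weight (double e) l (j ℕ.+ k) * h (ι k)) L≡))
                  (weight-exchange r (double e) L′ j {h} bh)))
      (binSum-nonneg (double e) (λ i i≤a → *-nonneg
        (<⇒≤ (weight-pos r L′ i (ℕP.≤-trans i≤a (ℕP.≤-trans (ℕP.m≤n+m (double e) p) (ℕP.n≤1+n _)))
          (ℕP.≤-trans (ℕP.m∸n≤m L′ i) L′≤)))
        (square-nonneg (q (- (½ - ι L′ + ι i))))))
    where
    -- This is L - j, the parameter of the poles measured from level j. All poles lie between the
    -- levels j and n - j, so the coefficients after the exchange are positive.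
    L′ = suc (p ℕ.+ double e)
    h : ℚ → ℚ
    h x = q x * q x
    L≡ : suc (j ℕ.+ p ℕ.+ double e) ≡ j ℕ.+ L′
    L≡ = trans (cong suc (ℕP.+-assoc j p (double e))) (sym (ℕP.+-suc j (p ℕ.+ double e)))
    r≡ : r ≡ suc (double p ℕ.+ double e)
    r≡ = ℕP.+-cancelʳ-≡ (j ℕ.+ j) r _ (trans r+2j≡n (cong suc
      (trans (trans (cong double (ℕP.+-assoc j p e)) (double-+ j (p ℕ.+ e)))
             (trans (cong₂ ℕ._+_ (double≡+ j) (double-+ p e)) (ℕP.+-comm (j ℕ.+ j) _)))))
    L′≤ : L′ ℕ.≤ suc r
    L′≤ = s≤s (ℕP.≤-trans (ℕP.+-monoˡ-≤ (double e)
            (subst (p ℕ.≤_) (sym (double≡+ p)) (ℕP.m≤m+n p p)))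
          (ℕP.≤-trans (ℕP.n≤1+n _) (ℕP.≤-reflexive (sym r≡))))
    -- This equality fixes the admissible levels t: q has degree below L′, and the exchange accepts
    -- degree at most r + 2e = 2L′ - 1 for q².
    2L′≡ : L′ ℕ.+ L′ ≡ suc (r ℕ.+ double e)
    2L′≡ = trans (sym (double≡+ L′)) (cong suc (trans
      (cong suc (trans (double-+ p (double e)) (trans (cong (double p ℕ.+_) (double≡+ (double e)))
                                                     (sym (ℕP.+-assoc (double p) (double e) (double e))))))
      (cong (ℕ._+ double e) (sym r≡))))
    T∸j≤ : T ℕ.∸ j ℕ.≤ L′
    T∸j≤ = ℕP.m≤n+o⇒m∸n≤o T j (ℕP.≤-trans T≤ (ℕP.≤-reflexive L≡))
    bh : Poly (suc (r ℕ.+ double e)) h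
    bh = below-≤ univariate (ℕP.≤-trans (ℕP.+-mono-≤ T∸j≤ T∸j≤) (ℕP.≤-reflexive 2L′≡))
      (poly-product {p = q} {q = q} bq bq)

  -- Exchange with h = 1: the weights themselves change sign on the outer levels, but every
  -- coefficient at a pole is positive.
  mass-pos : ∀ e M → 0ℚ < binSum (suc (double (M ℕ.+ e))) (weight (double e) (suc (M ℕ.+ double e)))
  mass-pos e M = subst (0ℚ <_)
    (trans (sym (weight-exchange n (double e) L 0 (below-≤ univariate (s≤s z≤n) poly-one)))
           (binSum-cong n (λ k → *-identityʳ (weight (double e) L k))))
    (binSum-pos (double e) (λ i i≤a → subst (0ℚ <_) (sym (*-identityʳ (weight n L i)))
      (weight-pos n L i (ℕP.≤-trans i≤a (ℕP.m≤n⇒m≤1+n (ℕP.m≤n+m (double e) M)))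
        (ℕP.≤-trans (ℕP.m∸n≤m L i) (s≤s (ℕP.m≤n⇒m≤1+n
          (subst₂ ℕ._≤_ refl (sym (double-+ M e))
            (ℕP.+-monoˡ-≤ (double e) (subst (M ℕ.≤_) (sym (double≡+ M)) (ℕP.m≤m+n M M))))))))))
    where
    n = suc (double (M ℕ.+ e))
    L = suc (M ℕ.+ double e)

  -- The objective value

  falling : ℚ → ℕ → ℚ
  falling x zero    = 1ℚ
  falling x (suc r) = falling x r * (x - ι r)

  falling-poly : ∀ c r → Poly (suc r) (λ x → falling (x + c) r)
  falling-poly c zero    = poly-one
  falling-poly c (suc r) = below-ext univariate (λ x → cong (falling (x + c) r *_) (sym (+-assoc x c (- ι r))))
    (poly-*-linear (c - ι r) (falling-poly c r))

  falling-ι-zero : ∀ j r → j ℕ.< r → falling (ι j) r ≡ 0ℚ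
  falling-ι-zero j (suc r) (s≤s j≤r) with ℕP.m≤n⇒m<n∨m≡n j≤r
  ... | inj₁ j<r  = trans (cong (_* (ι j - ι r)) (falling-ι-zero j r j<r)) (*-zeroˡ (ι j - ι r))
  ... | inj₂ refl = trans (cong (falling (ι j) r *_) (+-inverseʳ (ι j))) (*-zeroʳ (falling (ι j) r))

  falling-ι-nonneg : ∀ j r → 0ℚ ≤ falling (ι j) r
  falling-ι-nonneg j zero    = nonNegative⁻¹ 1ℚ
  falling-ι-nonneg j (suc r) with ℕP.≤-<-connex r j
  ... | inj₁ r≤j = *-nonneg (falling-ι-nonneg j r) (difference-nonneg (ι-mono-≤ r≤j))
  ... | inj₂ j<r = ≤-reflexive (sym (falling-ι-zero j (suc r) (ℕP.m≤n⇒m≤1+n j<r)))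

  falling-neg-sign : ∀ j r → 0ℚ ≤ sgn r * falling (- ι j) r
  falling-neg-sign j zero    = nonNegative⁻¹ 1ℚ
  falling-neg-sign j (suc r) = subst (0ℚ ≤_) (regroup (sgn r) (falling (- ι j) r) (ι j) (ι r))
    (*-nonneg (falling-neg-sign j r) (+-nonneg (ι-nonneg j) (ι-nonneg r)))
    where
    regroup : ∀ s f j r → s * f * (j + r) ≡ - s * (f * (- j - r))
    regroup = solve-∀ ℚ-ring

  -- f_d on level k for d = e + 1 and m = M + e, since then k + d - m - 1 = k - M. It vanishes on
  -- the levels M, ..., M + 2e + 1.
  profile : ℕ → ℕ → ℕ → ℚ
  profile e M k = falling (ι k - ι M) (2 ℕ.+ double e)

  factorial : ℕ → ℚ
  factorial zero    = 1ℚ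
  factorial (suc r) = ι (suc r) * factorial r

  factorial-pos : ∀ r → 0ℚ < factorial r
  factorial-pos zero    = positive⁻¹ 1ℚ
  factorial-pos (suc r) = *-pos (ι-pos r) (factorial-pos r)

  -- The product v (v+1) ⋯ (v+r) occurs in both factors, once up to sign and once inverted; the
  -- induction peels off its last term.
  falling-*-recipDiff : ∀ r v → NonInteger v →
    falling (- v) (suc r) * recipDiff r v ≡ sgn (suc r) * factorial r
  falling-*-recipDiff zero v v≢0 = trans (regroup v (recip (v + 0ℚ)))
    (trans (cong (λ z → - z * 1ℚ) (recip-inverse (v≢0 0))) refl)
    where
    regroup : ∀ v ρ → 1ℚ * (- v - 0ℚ) * (1ℚ * ρ) ≡ - ((v + 0ℚ) * ρ) * 1ℚ
    regroup = solve-∀ ℚ-ring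
  falling-*-recipDiff (suc r) v v≢0 = begin
    f * (- v - ι (suc r)) * recipDiff (suc r) v
      ≡⟨ regroup f v (ι (suc r)) (recipDiff (suc r) v) ⟩
    - (f * ((v + ι (suc r)) * recipDiff (suc r) v))
      ≡⟨ cong (λ z → - (f * z)) (recipDiff-upper r v v≢0) ⟩
    - (f * (ι (suc r) * recipDiff r v))
      ≡⟨ commute f (ι (suc r)) (recipDiff r v) ⟩
    - (ι (suc r) * (f * recipDiff r v))
      ≡⟨ cong (λ z → - (ι (suc r) * z)) (falling-*-recipDiff r v v≢0) ⟩
    - (ι (suc r) * (sgn (suc r) * factorial r))
      ≡⟨ collect (ι (suc r)) (sgn (suc r)) (factorial r) ⟩
    - sgn (suc r) * (ι (suc r) * factorial r) ∎
    where
    open ≡-Reasoning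
    f = falling (- v) (suc r)
    regroup : ∀ f v i d → f * (- v - i) * d ≡ - (f * ((v + i) * d))
    regroup = solve-∀ ℚ-ring
    commute : ∀ f i d → - (f * (i * d)) ≡ - (i * (f * d))
    commute = solve-∀ ℚ-ring
    collect : ∀ i s g → - (i * (s * g)) ≡ - s * (i * g)
    collect = solve-∀ ℚ-ring

  module Negativity (e : ℕ) where

    -- The point v with v + e + ½ = i - f, so that i = 0, ..., 2f runs through a unit grid centred
    -- at y = 0.
    node : ℕ → ℕ → ℚ
    node f i = ½ - ι (f ℕ.+ suc e) + ι i

    -- Up to sign and a positive factor, ∏_{l=0}^{c-1} 1/(κ l ² - y²) as a function of y = v + e + ½.
    density : ℕ → ℚ → ℚ
    density c v = falling (- v) (2 ℕ.+ double e) * recipDiff (suc (double (c ℕ.+ e))) (v - ι c)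

    κ : ℕ → ℚ
    κ c = ι (suc (c ℕ.+ e)) + ½

    -- Ratio of the factorials contained in the `recipDiff` factors of two consecutive densities.
    ρ : ℕ → ℚ
    ρ c = ι (3 ℕ.+ double (c ℕ.+ e)) * ι (2 ℕ.+ double (c ℕ.+ e))

    -- The central difference of order 2f of the c-th density at the centre of symmetry.
    centralDiff : ℕ → ℕ → ℚ
    centralDiff c f = altSum (double f) (λ i → density c (node f i))

    -- Passing from c to c + 1 adds one factor at each end of the product in the denominator, `w`
    -- and `w + R₂`. These are y - κ and y + κ, so removing them multiplies by y² - κ².
    density-suc : ∀ c f i → ρ c * density c (node f i) ≡
      (- ι f + ι i) * ((- ι f + ι i) * density (suc c) (node f i)) -
      κ c * κ c * density (suc c) (node f i)
    density-suc c f i = begin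
      R₂ * R₁ * (φ * recipDiff r (v - ι c))
        ≡⟨ regroup R₂ R₁ φ (recipDiff r (v - ι c)) ⟩
      φ * (R₂ * (R₁ * recipDiff r (v - ι c)))
        ≡⟨ cong (λ z → φ * (R₂ * (R₁ * recipDiff r z))) (raise v (ι c)) ⟨
      φ * (R₂ * (R₁ * recipDiff r (w + 1ℚ)))
        ≡⟨ cong (λ z → φ * (R₂ * z)) (recipDiff-lower r w w≢0) ⟨
      φ * (R₂ * (w * recipDiff (suc r) w))
        ≡⟨ commute φ R₂ w (recipDiff (suc r) w) ⟩
      φ * (w * (R₂ * recipDiff (suc r) w))
        ≡⟨ cong (λ z → φ * (w * z)) (recipDiff-upper (suc r) w w≢0) ⟨
      φ * (w * ((w + R₂) * D))
        ≡⟨ cong (λ z → φ * (z * ((z + R₂) * D)))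
             (cong (λ z → ½ - z + ι i - ι (suc c)) (ι-+ f (suc e))) ⟩
      φ * (w′ * ((w′ + R₂) * D))
        ≡⟨ cong (λ z → φ * (w′ * ((w′ + (1ℚ + (1ℚ + (1ℚ + z)))) * D)))
             (trans (ι-double (c ℕ.+ e)) (cong (λ z → z + z) (ι-+ c e))) ⟩
      φ * (w′ * ((w′ + (1ℚ + (1ℚ + (1ℚ + ((ι c + ι e) + (ι c + ι e)))))) * D))
        ≡⟨ factor φ (ι f) (ι e) (ι i) (ι c) D ⟩
      y * (y * (φ * D)) - (1ℚ + (ι c + ι e) + ½) * (1ℚ + (ι c + ι e) + ½) * (φ * D)
        ≡⟨ cong (λ z → y * (y * (φ * D)) - (1ℚ + z + ½) * (1ℚ + z + ½) * (φ * D)) (ι-+ c e) ⟨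
      y * (y * (φ * D)) - κ c * κ c * (φ * D) ∎
      where
      open ≡-Reasoning
      r = suc (double (c ℕ.+ e))
      R₂ = ι (2 ℕ.+ r)
      R₁ = ι (1 ℕ.+ r)
      v = node f i
      y = - ι f + ι i
      φ = falling (- v) (2 ℕ.+ double e)
      w = v - ι (suc c)
      w′ = ½ - (ι f + (1ℚ + ι e)) + ι i - (1ℚ + ι c)
      D = recipDiff (2 ℕ.+ r) w
      w≢0 : NonInteger w
      w≢0 k eq = ½-ι+ι≢0 (f ℕ.+ suc e ℕ.+ suc c) (i ℕ.+ k) (trans
        (trans (cong₂ (λ p q → ½ - p + q) (ι-+ (f ℕ.+ suc e) (suc c)) (ι-+ i k))
               (rearrange (ι (f ℕ.+ suc e)) (ι (suc c)) (ι i) (ι k))) eq)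
        where
        rearrange : ∀ a b i k → ½ - (a + b) + (i + k) ≡ ½ - a + i - b + k
        rearrange = solve-∀ ℚ-ring
      raise : ∀ v c → v - (1ℚ + c) + 1ℚ ≡ v - c
      raise = solve-∀ ℚ-ring
      regroup : ∀ a b p d → a * b * (p * d) ≡ p * (a * (b * d))
      regroup = solve-∀ ℚ-ring
      commute : ∀ p a w d → p * (a * (w * d)) ≡ p * (w * (a * d))
      commute = solve-∀ ℚ-ring
      factor : ∀ p f e i c d →
        p * ((½ - (f + (1ℚ + e)) + i - (1ℚ + c)) *
          ((½ - (f + (1ℚ + e)) + i - (1ℚ + c) + (1ℚ + (1ℚ + (1ℚ + ((c + e) + (c + e)))))) * d)) ≡
        (- f + i) * ((- f + i) * (p * d)) - (1ℚ + (c + e) + ½) * (1ℚ + (c + e) + ½) * (p * d)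
      factor = solve-∀ ℚ-ring

    centralDiff-density : ∀ c f → ρ c * centralDiff c f ≡
      altSum (double f) (λ i → (- ι f + ι i) * ((- ι f + ι i) * density (suc c) (node f i))) -
      κ c * κ c * centralDiff (suc c) f
    centralDiff-density c f = begin
      ρ c * centralDiff c f
        ≡⟨ altSum-* (double f) (ρ c) _ ⟨
      altSum (double f) (λ i → ρ c * density c (node f i))
        ≡⟨ altSum-cong (double f) (density-suc c f) ⟩
      altSum (double f) (λ i → (- ι f + ι i) * ((- ι f + ι i) * density (suc c) (node f i)) -
                               κ c * κ c * density (suc c) (node f i))
        ≡⟨ altSum-- (double f) _ _ ⟩
      squared - altSum (double f) (λ i → κ c * κ c * density (suc c) (node f i))
        ≡⟨ cong (λ z → squared - z) (altSum-* (double f) (κ c * κ c) _) ⟩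
      squared - κ c * κ c * centralDiff (suc c) f ∎
      where
      open ≡-Reasoning
      squared = altSum (double f) (λ i → (- ι f + ι i) * ((- ι f + ι i) * density (suc c) (node f i)))

    signedDiff : ℕ → ℕ → ℚ
    signedDiff c f = sgn c * centralDiff c f

    signedDiff-zero : ∀ c → κ c * κ c * signedDiff (suc c) 0 ≡ ρ c * signedDiff c 0
    signedDiff-zero c = begin
      κ c * κ c * (- sgn c * centralDiff (suc c) 0)
        ≡⟨ regroup (κ c) (sgn c) (density (suc c) (node 0 0)) ⟩
      sgn c * (1ℚ * ((- 0ℚ + 0ℚ) * ((- 0ℚ + 0ℚ) * density (suc c) (node 0 0))) -
               κ c * κ c * centralDiff (suc c) 0)
        ≡⟨ cong (sgn c *_) (centralDiff-density c 0) ⟨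
      sgn c * (ρ c * centralDiff c 0)
        ≡⟨ commute (sgn c) (ρ c) (centralDiff c 0) ⟩
      ρ c * (sgn c * centralDiff c 0) ∎
      where
      open ≡-Reasoning
      regroup : ∀ k s g → k * k * (- s * (1ℚ * g)) ≡
        s * (1ℚ * ((- 0ℚ + 0ℚ) * ((- 0ℚ + 0ℚ) * g)) - k * k * (1ℚ * g))
      regroup = solve-∀ ℚ-ring
      commute : ∀ s r t → s * (r * t) ≡ r * (s * t)
      commute = solve-∀ ℚ-ring

    -- Moving y² past the central difference in `centralDiff-density`, by `altSum-square`, and
    -- isolating the difference of order 2f + 2 gives a recursion whose coefficients are all
    -- positive as long as f + 1 < κ c.
    signedDiff-suc : ∀ c f →
      (κ c - ι (suc f)) * (κ c + ι (suc f)) * signedDiff (suc c) (suc f) ≡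
      ρ c * signedDiff c (suc f) + ι (2 ℕ.+ double f) * ι (1 ℕ.+ double f) * signedDiff (suc c) f
    signedDiff-suc c f = begin
      (κ c - x) * (κ c + x) * (- sgn c * t)
        ≡⟨ regroup (κ c) x (sgn c) t (R * u) ⟩
      sgn c * ((- x * - x * t + R * u) - κ c * κ c * t) - sgn c * (R * u)
        ≡⟨ cong (λ z → sgn c * (z - κ c * κ c * t) - sgn c * (R * u)) square ⟨
      sgn c * (squared - κ c * κ c * t) - sgn c * (R * u)
        ≡⟨ cong (λ z → sgn c * z - sgn c * (R * u)) (centralDiff-density c (suc f)) ⟨
      sgn c * (ρ c * centralDiff c (suc f)) - sgn c * (R * u)
        ≡⟨ collect (sgn c) (ρ c) (centralDiff c (suc f)) R u ⟩
      ρ c * (sgn c * centralDiff c (suc f)) + R * (- sgn c * u) ∎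
      where
      open ≡-Reasoning
      x = ι (suc f)
      t = centralDiff (suc c) (suc f)
      u = centralDiff (suc c) f
      R = ι (2 ℕ.+ double f) * ι (1 ℕ.+ double f)
      squared = altSum (double (suc f)) (λ i → (- x + ι i) * ((- x + ι i) * density (suc c) (node (suc f) i)))
      regroup : ∀ k x s t w → (k - x) * (k + x) * (- s * t) ≡
        s * ((- x * - x * t + w) - k * k * t) - s * w
      regroup = solve-∀ ℚ-ring
      collect : ∀ s r a R u → s * (r * a) - s * (R * u) ≡ r * (s * a) + R * (- s * u)
      collect = solve-∀ ℚ-ring
      centre : - x + ι (2 ℕ.+ double f) ≡ - - x
      centre = trans (cong (λ z → - x + (1ℚ + (1ℚ + z))) (ι-double f)) (symmetric (ι f))
        where
        symmetric : ∀ f → - (1ℚ + f) + (1ℚ + (1ℚ + (f + f))) ≡ - - (1ℚ + f)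
        symmetric = solve-∀ ℚ-ring
      square : squared ≡ - x * - x * t + R * u
      -- Dropping both end nodes of the grid for `suc f` leaves the grid for `f`.
      square = trans (altSum-square (double f) (- x) (λ i → density (suc c) (node (suc f) i)) centre)
        (cong (λ z → - x * - x * t + R * z)
          (altSum-cong (double f) (λ i → cong (density (suc c)) (cancel (ι (f ℕ.+ suc e)) (ι i)))))
        where
        cancel : ∀ a i → ½ - (1ℚ + a) + (1ℚ + i) ≡ ½ - a + i
        cancel = solve-∀ ℚ-ring

    κ-pos : ∀ c → 0ℚ < κ c
    κ-pos c = +-pos-nonneg (ι-pos (c ℕ.+ e)) (nonNegative⁻¹ ½)

    ρ-pos : ∀ c → 0ℚ < ρ c
    ρ-pos c = *-pos (ι-pos (2 ℕ.+ double (c ℕ.+ e))) (ι-pos (1 ℕ.+ double (c ℕ.+ e)))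

    -- Induction on f. Strict positivity of the previous density is required at order 0 only: from
    -- there the second summand of `signedDiff-suc` carries strictness to higher orders. The bound f
    -- ≤ e keeps f below κ c.
    signedDiff-step : ∀ c → 0ℚ < signedDiff c 0 → (∀ f → f ℕ.≤ e → 0ℚ ≤ signedDiff c f) →
      ∀ f → f ℕ.≤ e → 0ℚ < signedDiff (suc c) f
    signedDiff-step c pos nonneg zero _ = *-cancel-pos (*-pos (κ-pos c) (κ-pos c))
      (subst (0ℚ <_) (sym (signedDiff-zero c)) (*-pos (ρ-pos c) pos))
    signedDiff-step c pos nonneg (suc f) f<e = *-cancel-pos
      (*-pos (subst (0ℚ <_) (regroup (ι (suc (c ℕ.+ e))) (ι (suc f)))
                (+-mono-≤-< (difference-nonneg (ι-mono-≤ {suc f} {suc (c ℕ.+ e)}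
                  (ℕP.m≤n⇒m≤1+n (ℕP.≤-trans f<e (ℕP.m≤n+m e c))))) (positive⁻¹ ½)))
             (+-pos-nonneg (κ-pos c) (ι-nonneg (suc f))))
      (subst (0ℚ <_) (sym (signedDiff-suc c f))
        (+-mono-≤-< (*-nonneg (<⇒≤ (ρ-pos c)) (nonneg (suc f) f<e))
          (*-pos (*-pos (ι-pos (1 ℕ.+ double f)) (ι-pos (double f)))
                 (signedDiff-step c pos nonneg f (ℕP.<⇒≤ f<e)))))
      where
      regroup : ∀ a b → a - b + ½ ≡ a + ½ - b
      regroup = solve-∀ ℚ-ring

    density-zero : ∀ f i → density 0 (node f i) ≡ factorial (suc (double e))
    density-zero f i = begin
      falling (- v) (2 ℕ.+ double e) * recipDiff (suc (double e)) (v - 0ℚ)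
        ≡⟨ cong (λ z → falling (- v) (2 ℕ.+ double e) * recipDiff (suc (double e)) z) (+-identityʳ v) ⟩
      falling (- v) (2 ℕ.+ double e) * recipDiff (suc (double e)) v
        ≡⟨ falling-*-recipDiff (suc (double e)) v v≢0 ⟩
      sgn (double (suc e)) * factorial (suc (double e))
        ≡⟨ cong (_* factorial (suc (double e))) (sgn-double (suc e)) ⟩
      1ℚ * factorial (suc (double e))
        ≡⟨ *-identityˡ _ ⟩
      factorial (suc (double e)) ∎
      where
      open ≡-Reasoning
      v = node f i
      v≢0 : NonInteger v
      v≢0 k eq = ½-ι+ι≢0 (f ℕ.+ suc e) (i ℕ.+ k) (trans
        (trans (cong (½ - ι (f ℕ.+ suc e) +_) (ι-+ i k)) (sym (+-assoc (½ - ι (f ℕ.+ suc e)) (ι i) (ι k)))) eq)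

    -- The density with c = 0 is constant, so its differences of positive order are zero rather than
    -- positive. Hence the conclusion starts at `suc c`, and 0 < M is assumed later.
    signedDiff-pos : ∀ c f → f ℕ.≤ e → 0ℚ < signedDiff (suc c) f
    signedDiff-pos zero = signedDiff-step 0 base-pos (λ f _ → base-nonneg f)
      where
      base-pos : 0ℚ < signedDiff 0 0
      base-pos = subst (0ℚ <_)
        (sym (trans (*-identityˡ _) (trans (*-identityˡ _) (density-zero 0 0)))) (factorial-pos (suc (double e)))
      base-nonneg : ∀ f → 0ℚ ≤ signedDiff 0 f
      base-nonneg zero    = <⇒≤ base-pos
      base-nonneg (suc f) = ≤-reflexive (sym (trans (*-identityˡ _)
        (altSum-const (suc (double f)) (λ i → trans (density-zero (suc f) (suc i)) (sym (density-zero (suc f) i))))))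
    signedDiff-pos (suc c) = signedDiff-step (suc c) (signedDiff-pos c 0 z≤n)
      (λ f f≤e → <⇒≤ (signedDiff-pos c f f≤e))

    -- After the exchange, weight times profile at a pole is the density with c = M, so the
    -- objective becomes a central difference of order 2e. The minus sign arises because L - M = 2e
    -- + 1 is odd.
    value : ∀ M → 0 ℕ.< M →
      binSum (suc (double (M ℕ.+ e))) (λ k → weight (double e) (suc (M ℕ.+ double e)) k * profile e M k) ≡
      - signedDiff M e
    value M 0<M = begin
      binSum n (λ k → weight a L k * profile e M k)
        ≡⟨ weight-exchange n a L 0 (below-≤ univariate (degree M 0<M) (falling-poly (- ι M) (2 ℕ.+ a))) ⟩
      binSum a (λ i → weight n L i * falling (- (½ - ι L + ι i) - ι M) (2 ℕ.+ a))
        ≡⟨ binSum-cong a pointwise ⟩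
      binSum a (λ i → sgn L * (sgn i * density M (node e i)))
        ≡⟨ binSum-* a (sgn L) _ ⟩
      sgn L * centralDiff M e
        ≡⟨ cong (λ z → - z * centralDiff M e) (trans (sgn-+ M a)
             (trans (cong (sgn M *_) (sgn-double e)) (*-identityʳ (sgn M)))) ⟩
      - sgn M * centralDiff M e
        ≡⟨ neg-distribˡ-* (sgn M) (centralDiff M e) ⟨
      - signedDiff M e ∎
      where
      open ≡-Reasoning
      a = double e
      n = suc (double (M ℕ.+ e))
      L = suc (M ℕ.+ a)
      -- The profile has degree 2e + 2 and the exchange accepts degree n + 2e; 0 < M ensures n ≥ 2.
      degree : ∀ M → 0 ℕ.< M → 3 ℕ.+ a ℕ.≤ suc (suc (double (M ℕ.+ e)) ℕ.+ a)
      degree (suc c) _ = ℕP.+-monoˡ-≤ a (s≤s (s≤s (s≤s z≤n)))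
      pole : ∀ i → ½ - ι L + ι i ≡ node e i - ι M
      pole i = trans (cong (λ z → ½ - (1ℚ + z) + ι i) (trans (ι-+ M a) (cong (ι M +_) (ι-double e))))
        (trans (regroup (ι M) (ι e) (ι i)) (cong (λ z → ½ - z + ι i - ι M) (sym (ι-+ e (suc e)))))
        where
        regroup : ∀ m e i → ½ - (1ℚ + (m + (e + e))) + i ≡ ½ - (e + (1ℚ + e)) + i - m
        regroup = solve-∀ ℚ-ring
      pointwise : ∀ i → weight n L i * falling (- (½ - ι L + ι i) - ι M) (2 ℕ.+ a) ≡
        sgn L * (sgn i * density M (node e i))
      pointwise i = begin
        sgn L * sgn i * recipDiff n (½ - ι L + ι i) * falling (- (½ - ι L + ι i) - ι M) (2 ℕ.+ a)
          ≡⟨ cong (λ z → sgn L * sgn i * recipDiff n z * falling (- z - ι M) (2 ℕ.+ a)) (pole i) ⟩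
        sgn L * sgn i * recipDiff n (node e i - ι M) * falling (- (node e i - ι M) - ι M) (2 ℕ.+ a)
          ≡⟨ cong (λ z → sgn L * sgn i * recipDiff n (node e i - ι M) * falling z (2 ℕ.+ a))
               (cancel (node e i) (ι M)) ⟩
        sgn L * sgn i * recipDiff n (node e i - ι M) * falling (- node e i) (2 ℕ.+ a)
          ≡⟨ regroup (sgn L) (sgn i) (recipDiff n (node e i - ι M)) (falling (- node e i) (2 ℕ.+ a)) ⟩
        sgn L * (sgn i * density M (node e i)) ∎
        where
        cancel : ∀ v m → - (v - m) - m ≡ - v
        cancel = solve-∀ ℚ-ring
        regroup : ∀ s t d p → s * t * d * p ≡ s * (t * (p * d))
        regroup = solve-∀ ℚ-ring

    value-neg : ∀ M → 0 ℕ.< M →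
      binSum (suc (double (M ℕ.+ e))) (λ k → weight (double e) (suc (M ℕ.+ double e)) k * profile e M k) < 0ℚ
    value-neg M 0<M = subst (_< 0ℚ) (sym (value M 0<M)) (neg-antimono-< (positive-at M 0<M))
      where
      positive-at : ∀ M → 0 ℕ.< M → 0ℚ < signedDiff M e
      positive-at (suc c) _ = signedDiff-pos c e ℕP.≤-refl

  -- The relaxation over the reals

  fromℕ-ι : ∀ k → ℤ.+ k / 1 ≡ ι k
  fromℕ-ι zero    = refl
  fromℕ-ι (suc k) = trans (toℚᵘ-injective step) (cong (1ℚ +_) (fromℕ-ι k))
    where
    open ℚᵘP.≃-Reasoning
    step : toℚᵘ (ℤ.+ suc k / 1) ℚᵘ.≃ toℚᵘ (1ℚ + ℤ.+ k / 1)
    step = begin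
      toℚᵘ (ℤ.+ suc k / 1)                      ≈⟨ toℚᵘ-fromℚᵘ (ℚᵘ.mkℚᵘ (ℤ.+ suc k) 0) ⟩
      ℚᵘ.mkℚᵘ (ℤ.+ suc k) 0                     ≈⟨ ℚᵘ.*≡* (cong (λ z → (ℤ.+ 1 ℤ.+ z) ℤ.* ℤ.+ 1) (sym (ℤP.*-identityʳ (ℤ.+ k)))) ⟩
      ℚᵘ.1ℚᵘ ℚᵘ.+ ℚᵘ.mkℚᵘ (ℤ.+ k) 0             ≈⟨ ℚᵘP.+-congʳ ℚᵘ.1ℚᵘ (toℚᵘ-fromℚᵘ (ℚᵘ.mkℚᵘ (ℤ.+ k) 0)) ⟨
      toℚᵘ 1ℚ ℚᵘ.+ toℚᵘ (ℤ.+ k / 1)             ≈⟨ toℚᵘ-homo-+ 1ℚ (ℤ.+ k / 1) ⟨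
      toℚᵘ (1ℚ + ℤ.+ k / 1)                     ∎

  listSum : {A : Set} → List A → (A → ℚ) → ℚ
  listSum []       g = 0ℚ
  listSum (x ∷ xs) g = g x + listSum xs g

  listSum-cong : ∀ {A : Set} (xs : List A) {g h} → (∀ x → g x ≡ h x) → listSum xs g ≡ listSum xs h
  listSum-cong []       eq = refl
  listSum-cong (x ∷ xs) eq = cong₂ _+_ (eq x) (listSum-cong xs eq)

  listSum-* : ∀ {A : Set} (xs : List A) c g → listSum xs (λ x → c * g x) ≡ c * listSum xs g
  listSum-* []       c g = sym (*-zeroʳ c)
  listSum-* (x ∷ xs) c g = trans (cong (c * g x +_) (listSum-* xs c g)) (sym (*-distribˡ-+ c (g x) (listSum xs g)))

  listSum-++ : ∀ {A : Set} (xs ys : List A) g → listSum (xs ++ ys) g ≡ listSum xs g + listSum ys g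
  listSum-++ []       ys g = sym (+-identityˡ (listSum ys g))
  listSum-++ (x ∷ xs) ys g = trans (cong (g x +_) (listSum-++ xs ys g)) (sym (+-assoc (g x) (listSum xs g) (listSum ys g)))

  listSum-map : ∀ {A B : Set} (f : A → B) xs g → listSum (map f xs) g ≡ listSum xs (g ∘ f)
  listSum-map f []       g = refl
  listSum-map f (x ∷ xs) g = cong (g (f x) +_) (listSum-map f xs g)

  listSum-allSubsets : ∀ n F → listSum (allSubsets n) F ≡ cubeSum n F
  listSum-allSubsets zero    F = +-identityʳ (F [])
  listSum-allSubsets (suc n) F = trans (listSum-++ (map (false ∷_) (allSubsets n)) _ F)
    (cong₂ _+_ (trans (listSum-map (false ∷_) (allSubsets n) F) (listSum-allSubsets n _))
               (trans (listSum-map (true ∷_) (allSubsets n) F) (listSum-allSubsets n _)))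

  listSum-cubeSum : ∀ {A : Set} (xs : List A) n (F : A → Cube n → ℚ) →
    listSum xs (λ x → cubeSum n (F x)) ≡ cubeSum n (λ z → listSum xs (λ x → F x z))
  listSum-cubeSum []       n F = sym (trans (cubeSum-* n 0ℚ (λ _ → 0ℚ)) (*-zeroˡ (cubeSum n (λ _ → 0ℚ))))
  listSum-cubeSum (x ∷ xs) n F = trans (cong (cubeSum n (F x) +_) (listSum-cubeSum xs n F)) (sym (cubeSum-+ n _ _))

  seq-sumOver : ∀ {A : Set} (xs : List A) (g : A → ℝ) i → seq (sumOver xs g) i ≡ listSum xs (λ x → seq (g x) i)
  seq-sumOver []       g i = refl
  seq-sumOver (x ∷ xs) g i = cong (seq (g x) i +_) (seq-sumOver xs g i)

  seq-sumSubsets : ∀ n (g : Subset n → ℝ) i → seq (sumOver (allSubsets n) g) i ≡ cubeSum n (λ I → seq (g I) i)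
  seq-sumSubsets n g i = trans (seq-sumOver (allSubsets n) g i) (listSum-allSubsets n _)

  pointwise-≈ : ∀ x y → (∀ i → seq x i ≡ seq y i) → x D.≈ y
  pointwise-≈ x y eq ε 0<ε = 0 , λ i _ → subst (_< ε)
    (sym (trans (cong (λ q → ∣ seq x i - q ∣) (sym (eq i))) (cong ∣_∣ (+-inverseʳ (seq x i))))) 0<ε

  pointwise-nonneg : ∀ x → (∀ i → 0ℚ ≤ seq x i) → 0ℝ D.≤ x
  pointwise-nonneg x h ε 0<ε = 0 , λ i _ → +-mono-≤-< (h i) 0<ε

  -- As a function of `I` this is the monomial in the coordinates belonging to `J`.
  zeta-multilinear : ∀ {n} (J : Subset n) i →
    MultilinearBelow n (suc Subset.∣ J ∣) (λ I → seq (if does (J ⊆? I) then 1ℝ else 0ℝ) i)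
  zeta-multilinear []          i = tt
  zeta-multilinear {suc n} (false ∷ J) i = zeta-multilinear J i ,
    below-ext (multilinear n) (λ z → sym (+-inverseʳ (seq (if does (J ⊆? z) then 1ℝ else 0ℝ) i)))
      (below-zero (multilinear n) Subset.∣ J ∣)
  zeta-multilinear {suc n} (true ∷ J)  i = below-zero (multilinear n) (2 ℕ.+ Subset.∣ J ∣) ,
    below-ext (multilinear n) (λ z → sym (+-identityʳ (seq (if does (J ⊆? z) then 1ℝ else 0ℝ) i)))
      (zeta-multilinear J i)

  listSum-multilinear : ∀ {A : Set} {n T} (xs : List A) (w : A → ℚ) (g : A → Cube n → ℚ) →
    (∀ x → MultilinearBelow n T (g x)) → MultilinearBelow n T (λ z → listSum xs (λ x → w x * g x z))
  listSum-multilinear {n = n} {T} []       w g bg = below-zero (multilinear n) T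
  listSum-multilinear {n = n} {T} (x ∷ xs) w g bg =
    below-+ (multilinear n) {T} (below-* (multilinear n) {T} (w x) (bg x)) (listSum-multilinear xs w g bg)

  symmetricMeasure : ∀ {n} → (ℕ → ℚ) → Subset n → ℝ
  symmetricMeasure Y I = fromℚ (Y ‖ I ‖₁)

  -- The measure is a constant sequence, so at every index of the Cauchy sequences the real form is
  -- a rational form of the kind treated by `cubeForm-nonneg`. Semidefiniteness for all real vectors
  -- thus follows index by index.
  quadraticForm : ∀ t {n} Y (v : 𝒫 t n → ℝ) i →
    let p = λ I → listSum (all𝒫 t n) (λ J → seq (v J) i * seq (zeta I J) i) in
    seq (sumOver (all𝒫 t n) λ J → sumOver (all𝒫 t n) λ K → v J D.* momentMatrix t (symmetricMeasure Y) J K D.* v K) i ≡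
    cubeSum n (λ I → Y ‖ I ‖₁ * (p I * p I))
  quadraticForm t {n} Y v i = begin
    seq (sumOver P λ J → sumOver P λ K → v J D.* momentMatrix t (symmetricMeasure Y) J K D.* v K) i
      ≡⟨ seq-sumOver P _ i ⟩
    listSum P (λ J → seq (sumOver P λ K → v J D.* momentMatrix t (symmetricMeasure Y) J K D.* v K) i)
      ≡⟨ listSum-cong P (λ J → trans (seq-sumOver P _ i)
           (trans (listSum-cong P (λ K → entry J K)) (listSum-cubeSum P n _))) ⟩
    listSum P (λ J → cubeSum n (λ I → listSum P (λ K → Y ‖ I ‖₁ * (w J * ζ I J) * (w K * ζ I K))))
      ≡⟨ listSum-cubeSum P n _ ⟩
    cubeSum n (λ I → listSum P (λ J → listSum P (λ K → Y ‖ I ‖₁ * (w J * ζ I J) * (w K * ζ I K))))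
      ≡⟨ cubeSum-cong n square ⟩
    cubeSum n (λ I → Y ‖ I ‖₁ * (p I * p I)) ∎
    where
    open ≡-Reasoning
    P = all𝒫 t n
    w : 𝒫 t n → ℚ
    w J = seq (v J) i
    ζ : Subset n → 𝒫 t n → ℚ
    ζ I J = seq (zeta I J) i
    p : Subset n → ℚ
    p I = listSum P (λ J → w J * ζ I J)
    regroup : ∀ a b y f g → a * (y * (f * g)) * b ≡ y * (a * f) * (b * g)
    regroup = solve-∀ ℚ-ring
    entry : ∀ J K → seq (v J D.* momentMatrix t (symmetricMeasure Y) J K D.* v K) i ≡
      cubeSum n (λ I → Y ‖ I ‖₁ * (w J * ζ I J) * (w K * ζ I K))
    entry J K = begin
      w J * seq (momentMatrix t (symmetricMeasure Y) J K) i * w K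
        ≡⟨ cong (λ z → w J * z * w K) (seq-sumSubsets n _ i) ⟩
      w J * cubeSum n (λ I → Y ‖ I ‖₁ * (ζ I J * ζ I K)) * w K
        ≡⟨ cong (_* w K) (cubeSum-* n (w J) _) ⟨
      cubeSum n (λ I → w J * (Y ‖ I ‖₁ * (ζ I J * ζ I K))) * w K
        ≡⟨ *-comm _ (w K) ⟩
      w K * cubeSum n (λ I → w J * (Y ‖ I ‖₁ * (ζ I J * ζ I K)))
        ≡⟨ cubeSum-* n (w K) _ ⟨
      cubeSum n (λ I → w K * (w J * (Y ‖ I ‖₁ * (ζ I J * ζ I K))))
        ≡⟨ cubeSum-cong n (λ I → trans (*-comm (w K) _) (regroup (w J) (w K) (Y ‖ I ‖₁) (ζ I J) (ζ I K))) ⟩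
      cubeSum n (λ I → Y ‖ I ‖₁ * (w J * ζ I J) * (w K * ζ I K)) ∎
    square : ∀ I → listSum P (λ J → listSum P (λ K → Y ‖ I ‖₁ * (w J * ζ I J) * (w K * ζ I K))) ≡
      Y ‖ I ‖₁ * (p I * p I)
    square I = begin
      listSum P (λ J → listSum P (λ K → Y ‖ I ‖₁ * (w J * ζ I J) * (w K * ζ I K)))
        ≡⟨ listSum-cong P (λ J → trans (listSum-* P (Y ‖ I ‖₁ * (w J * ζ I J)) _)
             (rotate (Y ‖ I ‖₁) (w J * ζ I J) (p I))) ⟩
      listSum P (λ J → Y ‖ I ‖₁ * p I * (w J * ζ I J))
        ≡⟨ listSum-* P (Y ‖ I ‖₁ * p I) _ ⟩
      Y ‖ I ‖₁ * p I * p I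
        ≡⟨ *-assoc (Y ‖ I ‖₁) (p I) (p I) ⟩
      Y ‖ I ‖₁ * (p I * p I) ∎
      where
      rotate : ∀ a b c → a * b * c ≡ a * c * b
      rotate = solve-∀ ℚ-ring

  symmetric-feasible : ∀ t n Y → binSum n Y ≡ 1ℚ → PositiveOn Y n (suc t) →
    Feasible t {n} (symmetricMeasure Y)
  symmetric-feasible t n Y mass pos =
    pointwise-≈ (sumOver (allSubsets n) (symmetricMeasure Y)) 1ℝ (λ i →
      trans (seq-sumSubsets n (symmetricMeasure Y) i) (trans (cubeSum-symmetric n Y) mass)) ,
    (λ J K → pointwise-≈ (momentMatrix t (symmetricMeasure Y) J K) (momentMatrix t (symmetricMeasure Y) K J) (λ i →
      trans (seq-sumSubsets n _ i)
        (trans (cubeSum-cong n (λ I → cong (Y ‖ I ‖₁ *_) (*-comm (seq (zeta I J) i) (seq (zeta I K) i))))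
               (sym (seq-sumSubsets n _ i))))) ,
    λ v → pointwise-nonneg
      (sumOver (all𝒫 t n) λ J → sumOver (all𝒫 t n) λ K → v J D.* momentMatrix t (symmetricMeasure Y) J K D.* v K)
      (λ i → subst (0ℚ ≤_) (sym (quadraticForm t Y v i))
        (cubeForm-nonneg n Y {suc t}
          (listSum-multilinear (all𝒫 t n) (λ J → seq (v J) i) (λ J I → seq (zeta I J) i)
            (λ { (J , ∣J∣≤t) → below-≤ (multilinear n) (s≤s ∣J∣≤t) (zeta-multilinear J i) }))
          pos))

  cube-of-weight : ∀ n k → k ℕ.≤ n → ∃[ x ] (‖_‖₁ {n} x ≡ k)
  cube-of-weight zero    zero    _         = [] , refl
  cube-of-weight (suc n) zero    _         =
    let (x , eq) = cube-of-weight n zero z≤n in false ∷ x , eq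
  cube-of-weight (suc n) (suc k) (s≤s k≤n) =
    let (x , eq) = cube-of-weight n k k≤n in true ∷ x , cong suc eq

  seq-fallingFactorial : ∀ x r i → seq (fallingFactorial x r) i ≡ falling (seq x i) r
  seq-fallingFactorial x zero    i = refl
  seq-fallingFactorial x (suc r) i =
    cong₂ (λ p q → p * (seq x i - q)) (seq-fallingFactorial x r i) (fromℕ-ι r)

  2*≡double : ∀ k → 2 ℕ.* k ≡ double k
  2*≡double k = trans (cong (k ℕ.+_) (ℕP.+-identityʳ k)) (sym (double≡+ k))

  seq-fPoly : ∀ e M {n} (x : Cube n) i → seq (fPoly (suc e) (M ℕ.+ e) x) i ≡ profile e M ‖ x ‖₁
  seq-fPoly e M x i = trans (seq-fallingFactorial _ (2 ℕ.* suc e) i)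
    (cong₂ falling
      (trans (cong₂ (λ p q → p - q - 1ℚ)
                (cong₂ _+_ (fromℕ-ι ‖ x ‖₁) (fromℕ-ι (suc e))) (trans (fromℕ-ι (M ℕ.+ e)) (ι-+ M e)))
             (cancel (ι ‖ x ‖₁) (ι e) (ι M)))
      (2*≡double (suc e)))
    where
    cancel : ∀ k e m → k + (1ℚ + e) - (m + e) - 1ℚ ≡ k - m
    cancel = solve-∀ ℚ-ring

  -- A product of consecutive integers. For k ≥ M it starts at a nonnegative integer and descends,
  -- so it is positive or contains 0; for k ≤ M all factors are nonpositive and their number 2e + 2
  -- is even.
  profile-nonneg : ∀ e M k → 0ℚ ≤ profile e M k
  profile-nonneg e M k with ℕP.≤-total M k
  ... | inj₁ M≤k = subst (λ z → 0ℚ ≤ falling z (2 ℕ.+ double e)) (ι-∸ M≤k) (falling-ι-nonneg (k ℕ.∸ M) (2 ℕ.+ double e))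
  ... | inj₂ k≤M = subst (0ℚ ≤_)
      (trans (cong₂ _*_ (sgn-double (suc e)) (cong (λ z → falling z (2 ℕ.+ double e))
               (trans (cong -_ (ι-∸ k≤M)) (flip (ι M) (ι k))))) (*-identityˡ (profile e M k)))
      (falling-neg-sign (M ℕ.∸ k) (2 ℕ.+ double e))
    where
    flip : ∀ a b → - (a - b) ≡ b - a
    flip = solve-∀ ℚ-ring

  profile-zero : ∀ e M → profile e M M ≡ 0ℚ
  profile-zero e M = trans (cong (λ z → falling z (2 ℕ.+ double e)) (+-inverseʳ (ι M)))
    (falling-ι-zero 0 (2 ℕ.+ double e) (s≤s z≤n))

  fPoly-minimum : ∀ e M n → M ℕ.≤ n → IsMinimum {Cube n} (fPoly (suc e) (M ℕ.+ e)) 0ℝ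
  fPoly-minimum e M n M≤n =
    (let (x , ∣x∣≡M) = cube-of-weight n M M≤n in
     x , pointwise-≈ (fPoly (suc e) (M ℕ.+ e) x) 0ℝ (λ i → trans (seq-fPoly e M x i) (trans (cong (profile e M) ∣x∣≡M) (profile-zero e M)))) ,
    λ x → pointwise-nonneg (fPoly (suc e) (M ℕ.+ e) x) (λ i → subst (0ℚ ≤_) (sym (seq-fPoly e M x i)) (profile-nonneg e M ‖ x ‖₁))

  infimum-neg : ∀ {A : Set} {P : A → Set} (g : A → ℝ) a → P a → ∀ {q} → q < 0ℚ →
    (∀ i → seq (g a) i ≡ q) → D.infimum P g <ᵁ 0ℝ
  -- The witness q/2 separates q from 0, and the slack -q/4 serves for both strict inequalities.
  infimum-neg g a Pa {q} q<0 eq = ½ * q ,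
    (a , Pa , ε , 0<ε , 0 , λ i _ → subst (λ z → z + ε < ½ * q) (sym (eq i))
      (subst₂ _<_ (sum₁ q) (sum₂ q) (+-monoʳ-< (½ * q) (neg-antimono-< 0<ε)))) ,
    ε , 0<ε , 0 , λ i _ → subst (_< 0ℚ) (sum₃ q) (neg-antimono-< 0<ε)
    where
    ε = ½ * (½ * - q)
    0<½ : 0ℚ < ½
    0<½ = positive⁻¹ ½
    0<ε : 0ℚ < ε
    0<ε = *-pos 0<½ (*-pos 0<½ (neg-antimono-< q<0))
    sum₁ : ∀ q → ½ * q + - (½ * (½ * - q)) ≡ q + ½ * (½ * - q)
    sum₁ = solve-∀ ℚ-ring
    sum₂ : ∀ q → ½ * q + - 0ℚ ≡ ½ * q
    sum₂ = solve-∀ ℚ-ring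
    sum₃ : ∀ q → - (½ * (½ * - q)) ≡ ½ * q + ½ * (½ * - q)
    sum₃ = solve-∀ ℚ-ring

  -- Division by the total mass normalises the measure; the mass being positive, this preserves
  -- semidefiniteness and the sign of the objective.
  SoS-neg : ∀ t n (f : Cube n → ℝ) (φ w : ℕ → ℚ) → (∀ x i → seq (f x) i ≡ φ ‖ x ‖₁) →
    0ℚ < binSum n w → PositiveOn w n (suc t) → binSum n (λ k → w k * φ k) < 0ℚ → SoS t f <ᵁ 0ℝ
  SoS-neg t n f φ w f≡φ 0<mass pos v<0 = infimum-neg (objective f) (symmetricMeasure Y)
    (symmetric-feasible t n Y
      (trans (binSum-* n z w) (trans (*-comm z (binSum n w)) (recip-inverse (λ eq → <-irrefl (sym eq) 0<mass))))
      (λ j r eq q bq → subst (0ℚ ≤_)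
        (sym (trans (binSum-cong r (λ k → *-assoc z (w (j ℕ.+ k)) _)) (binSum-* r z _)))
        (*-nonneg (<⇒≤ 0<z) (pos j r eq q bq))))
    (subst (z * v <_) (*-zeroʳ z) (*-monoʳ-<-pos z {{positive 0<z}} v<0))
    (λ i → trans (seq-sumSubsets n _ i)
      (trans (cubeSum-cong n (λ I → trans (cong (Y ‖ I ‖₁ *_) (f≡φ I i)) (*-assoc z (w ‖ I ‖₁) (φ ‖ I ‖₁))))
      (trans (cubeSum-* n z _) (cong (z *_) (cubeSum-symmetric n (λ k → w k * φ k))))))
    where
    z = recip (binSum n w)
    v = binSum n (λ k → w k * φ k)
    Y : ℕ → ℚ
    Y k = z * w k
    0<z : 0ℚ < z
    0<z = recip-pos 0<mass

  ⌈double/2⌉ : ∀ k → ℕ.⌈ double k /2⌉ ≡ k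
  ⌈double/2⌉ zero    = refl
  ⌈double/2⌉ (suc k) = cong suc (⌈double/2⌉ k)

  fPoly-SoS : ∀ e M t → 0 ℕ.< M → t ℕ.< suc (M ℕ.+ double e) →
    SoS t {suc (double (M ℕ.+ e))} (fPoly (suc e) (M ℕ.+ e)) <ᵁ 0ℝ
  fPoly-SoS e M t 0<M t< =
    SoS-neg t (suc (double (M ℕ.+ e))) (fPoly (suc e) (M ℕ.+ e)) (profile e M)
      (weight (double e) (suc (M ℕ.+ double e)))
      (seq-fPoly e M) (mass-pos e M) (moment-nonneg e M (suc t) t<) (Negativity.value-neg e M 0<M)

  -- As n is odd, n + 2d - 1 is even and the ceiling is exact. The result is the degree bound of
  -- `moment-nonneg`, so t below it means `suc t` within that bound.
  levels : ∀ e M → ℕ.⌈ double (M ℕ.+ e) ℕ.+ 2 ℕ.* suc e /2⌉ ≡ suc (M ℕ.+ double e)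
  levels e M = begin
    ℕ.⌈ double (M ℕ.+ e) ℕ.+ 2 ℕ.* suc e /2⌉
      ≡⟨ cong (λ k → ℕ.⌈ double (M ℕ.+ e) ℕ.+ k /2⌉) (2*≡double (suc e)) ⟩
    ℕ.⌈ double (M ℕ.+ e) ℕ.+ double (suc e) /2⌉
      ≡⟨ cong ℕ.⌈_/2⌉ (double-+ (M ℕ.+ e) (suc e)) ⟨
    ℕ.⌈ double (M ℕ.+ e ℕ.+ suc e) /2⌉
      ≡⟨ ⌈double/2⌉ (M ℕ.+ e ℕ.+ suc e) ⟩
    M ℕ.+ e ℕ.+ suc e
      ≡⟨ trans (ℕP.+-suc (M ℕ.+ e) e) (cong suc (ℕP.+-assoc M e e)) ⟩
    suc (M ℕ.+ (e ℕ.+ e))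
      ≡⟨ cong (λ k → suc (M ℕ.+ k)) (double≡+ e) ⟨
    suc (M ℕ.+ double e) ∎
    where open ≡-Reasoning

  fPoly-gap : ∀ e M m n → 0 ℕ.< M → m ≡ M ℕ.+ e → n ≡ suc (double m) →
    ∃[ μ ] (IsMinimum {Cube n} (fPoly (suc e) m) μ ×
      (∀ t → 1 ℕ.≤ t → t ℕ.< ℕ.⌈ n ℕ.+ 2 ℕ.* suc e ℕ.∸ 1 /2⌉ → SoS t {n} (fPoly (suc e) m) <ᵁ μ))
  fPoly-gap e M .(M ℕ.+ e) .(suc (double (M ℕ.+ e))) 0<M refl refl =
    0ℝ , fPoly-minimum e M (suc (double (M ℕ.+ e))) M≤ ,
    λ t _ t< → fPoly-SoS e M t 0<M (subst (t ℕ.<_) (levels e M) t<)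
    where
    M≤ : M ℕ.≤ suc (double (M ℕ.+ e))
    M≤ = ℕP.m≤n⇒m≤1+n (subst (M ℕ.≤_) (sym (double≡+ (M ℕ.+ e)))
      (ℕP.≤-trans (ℕP.m≤m+n M e) (ℕP.m≤m+n (M ℕ.+ e) (M ℕ.+ e))))

open import Defs using (Cube; IsMinimum; SoS; _<ᵁ_; fPoly)
open import Data.Nat using (ℕ; suc; _+_; _*_; _∸_; _≤_; _<_; ⌈_/2⌉)
open import Data.Nat.Properties using (<⇒≤; +-comm; m<n⇒0<n∸m; m∸n+n≡m)
open import Data.Product using (_×_; ∃-syntax)
open import Relation.Binary.PropositionalEquality using (_≡_; sym; trans; cong)
open Pseudomoments using (fPoly-gap; 2*≡double)

theorem2 : (d m n : ℕ) → 1 ≤ d → d ≤ m → n ≡ 2 * m + 1 →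
    ∃[ μ ] (IsMinimum {Cube n} (fPoly d m) μ ×
    (∀ t → 1 ≤ t → t < ⌈ n + 2 * d ∸ 1 /2⌉ → SoS t {n} (fPoly d m) <ᵁ μ))
theorem2 (suc e) m n _ e<m n≡ =
  -- M = m - d + 1 is the lowest of the 2d middle levels, and d ≤ m makes it positive.
  fPoly-gap e (m ∸ e) m n (m<n⇒0<n∸m e<m) (sym (m∸n+n≡m (<⇒≤ e<m)))
    (trans n≡ (trans (+-comm (2 * m) 1) (cong suc (2*≡double m))))
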